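{- Let $N$ be an odd positive integer, written $N = 3^h N_0$ with $h \geq 0$ and $3 \nmid N_0$. For each positive divisor $d$ of $N_0$ let $k_d = \operatorname{ord}_d(3)$ (with $k_1 = 1$), and let $K_N = \sum_{d \mid N_0} \frac{\phi(d)}{k_d}$. Then $\det C_N = 0$ if $k_p$ is even for at least one prime $p \mid N_0$; $\det C_N = 2^{K_N}$ if $k_p$ is odd for all primes $p \mid N_0$ and $N \equiv \pm 1 \pmod 8$; $\det C_N = -2^{K_N}$ if $k_p$ is odd for all primes $p \mid N_0$ and $N \equiv \pm 3 \pmod 8$.
   Context: The Collatz function is $T(n) = n/2$ if $n$ is even and $T(n) = (3n+1)/2$ if $n$ is odd, for nonnegative integers $n$. For an integer $N \geq 1$ the modular Collatz graph $G_N$ has vertex set $\mathbb{Z}_N = \{0,1,\ldots,N-1\}$ and adjacency matrix $C_N = (c_{i,j})_{0 \le i,j \le N-1}$ with $c_{i,j} = \#\{\nu \in \{i, i+N\} : T(\nu) \equiv j \pmod N\}$; in particular $C_1 = (2)$. $\operatorname{ord}_d(3)$ is the multiplicative order of $3$ modulo $d$, with the convention $\operatorname{ord}_1(3) = 1$; $\phi$ is Euler's totient function. -}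

module Defs where

open import Data.Nat using (ℕ; zero; suc; _+_; _*_; _^_; _≡ᵇ_)
open import Data.Nat.DivMod using (_/_; _%_)
open import Data.Nat.GCD using (gcd)
open import Data.Nat.Divisibility using (_∣?_)
open import Data.Fin using (Fin; toℕ; punchIn)
import Data.Fin as Fin
open import Data.Bool using (Bool; true; false; if_then_else_)
open import Data.List using (List; filter; map; upTo; allFin; foldr; length)
open import Data.Nat.ListAction using (sum)
open import Relation.Binary.PropositionalEquality using (_≡_)
open import Data.Integer using (ℤ; +_; -_)
import Data.Integer as ℤ
open import Relation.Nullary using (does)

T : ℕ → ℕ
T n = if (n % 2) ≡ᵇ 0 then n / 2 else (3 * n + 1) / 2

𝟙 : Bool → ℤ
𝟙 true  = + 1
𝟙 false = + 0

-- Adjacency matrix C_N of the modular Collatz graph G_N: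
-- c_{i,j} = #{ ν ∈ {i, i+N} : T ν ≡ j (mod N) }.
C : (N : ℕ) → Fin N → Fin N → ℤ
C (suc m) i j =
  𝟙 ((T (toℕ i) % suc m) ≡ᵇ toℕ j) ℤ.+ 𝟙 ((T (toℕ i + suc m) % suc m) ≡ᵇ toℕ j)

det : (n : ℕ) → (Fin n → Fin n → ℤ) → ℤ
det zero    M = + 1
det (suc n) M =
  foldr ℤ._+_ (+ 0)
    (map (λ j → sgn (toℕ j) ℤ.* (M Fin.zero j ℤ.* det n (λ a b → M (Fin.suc a) (punchIn j b))))
         (allFin (suc n)))
  where
  sgn : ℕ → ℤ
  sgn zero          = + 1
  sgn (suc zero)    = - (+ 1)
  sgn (suc (suc k)) = sgn k

-- Multiplicative order of 3 modulo d (d ≥ 1): least k ≥ 1 with 3^k ≡ 1 (mod d).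
-- The search runs over k = 1 .. d, which suffices whenever gcd(3,d) = 1
-- (ord_d(3) ≤ φ(d) ≤ d); it returns 0 if no such k is found (never used).
-- For d = 1 this gives 1, matching the convention ord_1(3) = 1.
ordSearch : (d : ℕ) → (fuel k : ℕ) → ℕ
ordSearch d zero       k = 0
ordSearch zero (suc f) k = 0
ordSearch (suc d) (suc f) k =
  if ((3 ^ k) % suc d) ≡ᵇ (1 % suc d) then k else ordSearch (suc d) f (suc k)

ord3 : ℕ → ℕ
ord3 d = ordSearch d d 1

φ : ℕ → ℕ
φ d = length (filter (λ i → gcd (suc i) d Data.Nat.≟ 1) (upTo d))

-- natural-number division, total (division by 0 gives 0); exact whenever used
-- below since ord_d(3) ∣ φ(d).
_div_ : ℕ → ℕ → ℕ
a div zero  = 0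
a div suc b = a / suc b

divisors : ℕ → List ℕ
divisors n = filter (λ d → d ∣? n) (map suc (upTo n))

K : ℕ → ℕ
K N₀ = sum (map (λ d → φ d div ord3 d) (divisors N₀))

IsOdd : ℕ → Set
IsOdd n = n % 2 ≡ 1

IsEven : ℕ → Set
IsEven n = n % 2 ≡ 0

{-# OPTIONS --safe #-}
-- Write N = 2m + 1.  Row i of C_N is e_{p i} + e_{f (p i)}, where p halves modulo N
-- and f x = 3x + m + 1.  Let S collect the columns x whose row has been reduced from
-- e_x + e_{f x} to e_x.  If f x lies in S, subtracting a row moves x into S without
-- changing the determinant.  If x lies on an f-cycle of length k outside S, the
-- alternating sum of the rows along the cycle is e_x - (-1)^k e_x, so the determinant
-- vanishes for even k and is twice the one with x moved into S for odd k.  Hence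
-- det C_N is 0, or 2^(number of cycles) times the sign of p.
-- The map f is conjugate to multiplication by 3: its cycles lie in the elements whose
-- additive order d divides N₀, and there all have length ord_d(3), which is odd as soon
-- as ord_q(3) is odd for the primes q dividing d, because x ≡ 1 modulo q and modulo e
-- implies x^q ≡ 1 modulo q e.  The sign of p follows from two Laplace expansions, which
-- lead from N to N - 2 at the cost of (-1)^m.
module Submission where

open import Defs

-- Determinants by expansion along the first row.

module Determinant where

  open import Data.Nat as ℕ using (ℕ; zero; suc; z≤n; s≤s)
  open import Data.Fin as Fin using (Fin; zero; suc; toℕ; inject₁; punchIn)
  open import Data.Fin.Properties using (toℕ-inject₁; suc-injective)
  open import Data.Integer using (ℤ; +_; -_; _+_; _*_)
  open import Data.Integer.Properties
  open import Data.Integer.Tactic.RingSolver using (solve-∀)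
  open import Algebra.Properties.Semiring.Sum +-*-semiring using (sum; sum-cong-≗; ∑-distrib-+; *-distribˡ-sum; sum-replicate-zero)
  open import Data.List using (foldr; map; tabulate)
  open import Data.List.Properties using (map-cong; map-tabulate)
  open import Data.Vec.Functional using (updateAt)
  open import Data.Vec.Functional.Properties using (updateAt-updates; updateAt-minimal)
  open import Function using (_∘_; const)
  open import Relation.Nullary using (yes; no; contradiction)
  open import Relation.Binary.PropositionalEquality

  Matrix : ℕ → Set
  Matrix n = Fin n → Fin n → ℤ

  -- Flips at every step, unlike the two-step recursion inside `det`, so that the signs at
  -- neighbouring indices differ by a visible negation.
  sign : ℕ → ℤ
  sign zero    = + 1
  sign (suc k) = - sign k

  minor : ∀ {n} → Matrix (suc n) → Fin (suc n) → Matrix n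
  minor M j a b = M (suc a) (punchIn j b)

  foldr-tabulate : ∀ {n} (g : Fin n → ℤ) → foldr _+_ (+ 0) (tabulate g) ≡ sum g
  foldr-tabulate {zero}  g = refl
  foldr-tabulate {suc n} g = cong (λ z → g zero + z) (foldr-tabulate (g ∘ suc))

  cofactorTerm : ∀ {n} → Matrix (suc n) → Fin (suc n) → ℤ
  cofactorTerm {n} M j = sign (toℕ j) * (M zero j * det n (minor M j))

  -- The sign function local to det cannot be named here: the left-hand sides
  -- written _ are inferred from the unfolding of det.
  mutual
    det-expand : ∀ n (M : Matrix (suc n)) → det (suc n) M ≡ sum (cofactorTerm M)
    det-expand n M = cong (λ z → cofactorTerm M zero + z) (expand-tail n M)

    expand-tail : ∀ n (M : Matrix (suc n)) →
      foldr _+_ (+ 0) (map _ (tabulate {n = n} suc)) ≡ sum (λ j → cofactorTerm M (suc j))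
    expand-tail n M = trans
      (cong (foldr _+_ (+ 0)) (trans (map-cong (local-term n M) (tabulate suc)) (map-tabulate suc (cofactorTerm M))))
      (foldr-tabulate (λ j → cofactorTerm M (suc j)))

    local-term : ∀ n (M : Matrix (suc n)) (j : Fin (suc n)) → _ ≡ cofactorTerm M j
    -- Abstracting `toℕ j` leaves a free natural number for the two-step induction, while the minor
    -- stays at `j`.
    local-term n M j with toℕ j
    ... | k = local-term-at n M j k

    local-term-at : ∀ n (M : Matrix (suc n)) (j : Fin (suc n)) (k : ℕ) →
      _ ≡ sign k * (M zero j * det n (minor M j))
    local-term-at n M j zero          = refl
    local-term-at n M j (suc zero)    = refl
    local-term-at n M j (suc (suc k)) = trans (local-term-at n M j k)
      (cong (_* (M zero j * det n (minor M j))) (sym (neg-involutive (sign k))))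

  sum-zero : ∀ {n} (g : Fin n → ℤ) → (∀ j → g j ≡ + 0) → sum g ≡ + 0
  sum-zero {n} g g≡0 = trans (sum-cong-≗ g≡0) (sum-replicate-zero n)

  det-cong : ∀ {n} {M M′ : Matrix n} → (∀ i j → M i j ≡ M′ i j) → det n M ≡ det n M′
  det-cong {zero}          eq = refl
  det-cong {suc n} {M} {M′} eq = begin
    det (suc n) M                                                  ≡⟨ det-expand n M ⟩
    sum (cofactorTerm M)  ≡⟨ sum-cong-≗ (λ j → cong (sign (toℕ j) *_)
                                                                       (cong₂ _*_ (eq zero j) (det-cong (λ a b → eq (suc a) (punchIn j b))))) ⟩
    sum (cofactorTerm M′) ≡⟨ det-expand n M′ ⟨
    det (suc n) M′ ∎
    where open ≡-Reasoning

  AgreeOff : ∀ {n} → Fin n → Matrix n → Matrix n → Set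
  AgreeOff r M M′ = ∀ i → i ≢ r → ∀ j → M i j ≡ M′ i j

  -- Induction on `r`. For the first row the minors coincide and the entry splits; for a later row
  -- the entries of the first row coincide and the minors split.
  det-row-+ : ∀ {n} (r : Fin n) {M A B : Matrix n} → AgreeOff r M A → AgreeOff r M B →
    (∀ j → M r j ≡ A r j + B r j) → det n M ≡ det n A + det n B
  det-row-+ {suc n} r {M} {A} {B} MA MB split = begin
    det (suc n) M                  ≡⟨ det-expand n M ⟩
    sum (cofactorTerm M)                   ≡⟨ sum-cong-≗ (term-+ r MA MB split) ⟩
    sum (λ j → cofactorTerm A j + cofactorTerm B j) ≡⟨ ∑-distrib-+ (cofactorTerm A) (cofactorTerm B) ⟩
    sum (cofactorTerm A) + sum (cofactorTerm B)    ≡⟨ cong₂ _+_ (det-expand n A) (det-expand n B) ⟨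
    det (suc n) A + det (suc n) B ∎
    where
    open ≡-Reasoning
    distrib₁ : ∀ s a b d → s * ((a + b) * d) ≡ s * (a * d) + s * (b * d)
    distrib₁ = solve-∀
    distrib₂ : ∀ s a d e → s * (a * (d + e)) ≡ s * (a * d) + s * (a * e)
    distrib₂ = solve-∀

    term-+ : ∀ r → AgreeOff r M A → AgreeOff r M B → (∀ j → M r j ≡ A r j + B r j) →
      ∀ j → cofactorTerm M j ≡ cofactorTerm A j + cofactorTerm B j
    term-+ zero MA MB split j = begin
      sign (toℕ j) * (M zero j * det n (minor M j))
        ≡⟨ cong (λ x → sign (toℕ j) * (x * det n (minor M j))) (split j) ⟩
      sign (toℕ j) * ((A zero j + B zero j) * det n (minor M j))
        ≡⟨ distrib₁ (sign (toℕ j)) (A zero j) (B zero j) _ ⟩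
      sign (toℕ j) * (A zero j * det n (minor M j)) + sign (toℕ j) * (B zero j * det n (minor M j))
        ≡⟨ cong₂ (λ x y → sign (toℕ j) * (A zero j * x) + sign (toℕ j) * (B zero j * y))
             (det-cong (λ a b → MA (suc a) (λ ()) (punchIn j b)))
             (det-cong (λ a b → MB (suc a) (λ ()) (punchIn j b))) ⟩
      cofactorTerm A j + cofactorTerm B j ∎
    term-+ (suc r) MA MB split j = begin
      sign (toℕ j) * (M zero j * det n (minor M j))
        ≡⟨ cong (λ x → sign (toℕ j) * (M zero j * x))
             (det-row-+ r (λ i i≢r b → MA (suc i) (i≢r ∘ suc-injective) (punchIn j b))
                          (λ i i≢r b → MB (suc i) (i≢r ∘ suc-injective) (punchIn j b))
                          (λ b → split (punchIn j b))) ⟩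
      sign (toℕ j) * (M zero j * (det n (minor A j) + det n (minor B j)))
        ≡⟨ distrib₂ (sign (toℕ j)) (M zero j) _ _ ⟩
      sign (toℕ j) * (M zero j * det n (minor A j)) + sign (toℕ j) * (M zero j * det n (minor B j))
        ≡⟨ cong₂ (λ x y → sign (toℕ j) * (x * det n (minor A j)) + sign (toℕ j) * (y * det n (minor B j)))
             (MA zero (λ ()) j) (MB zero (λ ()) j) ⟩
      cofactorTerm A j + cofactorTerm B j ∎

  infixl 8 _[_]≔_

  _[_]≔_ : ∀ {n} → Matrix n → Fin n → (Fin n → ℤ) → Matrix n
  M [ r ]≔ v = updateAt M r (const v)

  ≔-hit : ∀ {n} (M : Matrix n) r {v} j → (M [ r ]≔ v) r j ≡ v j
  ≔-hit M r j = cong (λ row → row j) (updateAt-updates r M)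

  ≔-miss : ∀ {n} (M : Matrix n) r {v i} → i ≢ r → ∀ j → (M [ r ]≔ v) i j ≡ M i j
  ≔-miss M r {i = i} i≢r j = cong (λ row → row j) (updateAt-minimal i r M i≢r)

  det-≔-+ : ∀ {n} (M : Matrix n) r {u v w : Fin n → ℤ} → (∀ j → u j ≡ v j + w j) →
    det n (M [ r ]≔ u) ≡ det n (M [ r ]≔ v) + det n (M [ r ]≔ w)
  det-≔-+ M r split = det-row-+ r off off
    (λ j → trans (≔-hit M r j) (trans (split j) (sym (cong₂ _+_ (≔-hit M r j) (≔-hit M r j)))))
    where
    off : ∀ {u v} → AgreeOff r (M [ r ]≔ u) (M [ r ]≔ v)
    off i i≢r j = trans (≔-miss M r i≢r j) (sym (≔-miss M r i≢r j))

  ≔-self : ∀ {n} (M : Matrix n) r {v} → (∀ j → v j ≡ M r j) → ∀ i j → (M [ r ]≔ v) i j ≡ M i j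
  ≔-self M r v≡ i j with i Fin.≟ r
  ... | yes refl = trans (≔-hit M r j) (v≡ j)
  ... | no i≢r   = ≔-miss M r i≢r j

  -- Vanishing of the determinant when two rows are equal.

  Alternating : ∀ {n} → Fin n → Fin n → Set
  Alternating {n} r s = ∀ (M : Matrix n) → (∀ j → M r j ≡ M s j) → det n M ≡ + 0

  inverse-unique : ∀ x y → x + y ≡ + 0 → x ≡ - y
  inverse-unique x y x+y≡0 = trans (regroup x y) (trans (cong (_+ - y) x+y≡0) (+-identityˡ (- y)))
    where
    regroup : ∀ x y → x ≡ (x + y) + - y
    regroup = solve-∀

  -- Polarisation: 0 = det(u+v, u+v) = det(u,v) + det(v,u).
  alternating⇒antisym : ∀ {n} {r s : Fin n} → r ≢ s → Alternating r s → ∀ M u v →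
    det n (M [ r ]≔ u [ s ]≔ v) ≡ - det n (M [ r ]≔ v [ s ]≔ u)
  alternating⇒antisym {n} {r} {s} r≢s alt M u v = inverse-unique _ _ (begin
    B u v + B v u                           ≡⟨ cong₂ _+_ (sym (+-identityˡ (B u v))) (sym (+-identityʳ (B v u))) ⟩
    (+ 0 + B u v) + (B v u + + 0)           ≡⟨ cong₂ (λ x y → (x + B u v) + (B v u + y)) (B-alt u) (B-alt v) ⟨
    (B u u + B u v) + (B v u + B v v)       ≡⟨ cong₂ _+_ (B-+ʳ u) (B-+ʳ v) ⟨
    B u u+v + B v u+v                       ≡⟨ B-+ˡ u+v ⟨
    B u+v u+v                               ≡⟨ B-alt u+v ⟩
    + 0 ∎)
    where
    open ≡-Reasoning
    B : (Fin n → ℤ) → (Fin n → ℤ) → ℤ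
    B x y = det n (M [ r ]≔ x [ s ]≔ y)
    u+v : Fin n → ℤ
    u+v j = u j + v j
    at-r : ∀ x y j → (M [ r ]≔ x [ s ]≔ y) r j ≡ x j
    at-r x y j = trans (≔-miss (M [ r ]≔ x) s r≢s j) (≔-hit M r j)
    B-alt : ∀ x → B x x ≡ + 0
    B-alt x = alt _ (λ j → trans (at-r x x j) (sym (≔-hit (M [ r ]≔ x) s j)))
    B-+ʳ : ∀ x → B x u+v ≡ B x u + B x v
    B-+ʳ x = det-≔-+ (M [ r ]≔ x) s (λ _ → refl)
    off : ∀ {x x′ y} → AgreeOff r (M [ r ]≔ x [ s ]≔ y) (M [ r ]≔ x′ [ s ]≔ y)
    off {x} {x′} i i≢r j with i Fin.≟ s
    ... | yes refl = trans (≔-hit (M [ r ]≔ x) s j) (sym (≔-hit (M [ r ]≔ x′) s j))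
    ... | no i≢s   = trans (trans (≔-miss (M [ r ]≔ x) s i≢s j) (≔-miss M r i≢r j))
                       (sym (trans (≔-miss (M [ r ]≔ x′) s i≢s j) (≔-miss M r i≢r j)))
    B-+ˡ : ∀ y → B u+v y ≡ B u y + B v y
    B-+ˡ y = det-row-+ r off off
      (λ j → trans (at-r u+v y j) (sym (cong₂ _+_ (at-r u y j) (at-r v y j))))

  punchIn-inject₁-≤ : ∀ {n} {a b : Fin n} → a Fin.≤ b → punchIn (inject₁ a) b ≡ suc b
  punchIn-inject₁-≤ {a = zero}              _         = refl
  punchIn-inject₁-≤ {a = suc a} {b = suc b} (s≤s a≤b) = cong suc (punchIn-inject₁-≤ a≤b)

  punchIn-suc-≤ : ∀ {n} {a b : Fin n} → a Fin.≤ b → punchIn (suc b) a ≡ inject₁ a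
  punchIn-suc-≤ {a = zero}              _         = refl
  punchIn-suc-≤ {a = suc a} {b = suc b} (s≤s a≤b) = cong suc (punchIn-suc-≤ a≤b)

  -- Both sides enumerate the columns other than `a` and `b + 1`, deleted in either order.
  punchIn-punchIn-≤ : ∀ {n} {a b : Fin (suc n)} → a Fin.≤ b → ∀ c →
    punchIn (inject₁ a) (punchIn b c) ≡ punchIn (suc b) (punchIn a c)
  punchIn-punchIn-≤ {a = zero}              _         c       = refl
  punchIn-punchIn-≤ {a = suc a} {b = suc b} (s≤s a≤b) zero    = refl
  punchIn-punchIn-≤ {a = suc a} {b = suc b} (s≤s a≤b) (suc c) = cong suc (punchIn-punchIn-≤ a≤b c)

  -- For a ≤ b the index pairs (a, b) and (b + 1, a) delete the same two columns.
  sum-pairs-cancel : ∀ n (G : Fin (suc n) → Fin n → ℤ) →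
    (∀ a b → a Fin.≤ b → G (inject₁ a) b + G (suc b) a ≡ + 0) → sum (λ j → sum (G j)) ≡ + 0
  sum-pairs-cancel zero    G anti = refl
  sum-pairs-cancel (suc n) G anti = begin
    sum (G zero) + sum (λ j → G (suc j) zero + sum (λ k → G (suc j) (suc k)))
      ≡⟨ cong (λ z → sum (G zero) + z) (∑-distrib-+ (λ j → G (suc j) zero) (λ j → sum (λ k → G (suc j) (suc k)))) ⟩
    sum (G zero) + (sum (λ j → G (suc j) zero) + rest)
      ≡⟨ +-assoc (sum (G zero)) _ _ ⟨
    (sum (G zero) + sum (λ j → G (suc j) zero)) + rest
      -- The terms `G zero b` cancel against the terms `G (suc b) zero`; what remains is a sum of
      -- the same kind, one size smaller.
      ≡⟨ cong (_+ rest) (∑-distrib-+ (G zero) (λ j → G (suc j) zero)) ⟨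
    sum (λ b → G zero b + G (suc b) zero) + rest
      ≡⟨ cong₂ _+_ (sum-zero _ (λ b → anti zero b z≤n))
           (sum-pairs-cancel n (λ j k → G (suc j) (suc k)) (λ a b a≤b → anti (suc a) (suc b) (s≤s a≤b))) ⟩
    + 0 ∎
    where
    open ≡-Reasoning
    rest : ℤ
    rest = sum (λ j → sum (λ k → G (suc j) (suc k)))

  -- Expansion along the first two rows gives a double sum over ordered pairs of deleted columns.
  -- The two orders of a pair have the same second minor and, the rows being equal, the same product
  -- of entries, but opposite signs.
  alternating₀₁ : ∀ {n} → Alternating {suc (suc n)} zero (suc zero)
  alternating₀₁ {n} M M₀≡M₁ = begin
    det (suc (suc n)) M
      ≡⟨ det-expand (suc n) M ⟩
    sum (λ j → sign (toℕ j) * (M zero j * det (suc n) (minor M j)))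
      ≡⟨ sum-cong-≗ (λ j → trans
           (cong (λ x → sign (toℕ j) * (M zero j * x)) (det-expand n (minor M j)))
           (trans (cong (sign (toℕ j) *_) (*-distribˡ-sum (M zero j) (cofactorTerm (minor M j)))) (*-distribˡ-sum (sign (toℕ j)) (λ k → M zero j * cofactorTerm (minor M j) k)))) ⟩
    sum (λ j → sum (G j))
      ≡⟨ sum-pairs-cancel (suc n) G anti ⟩
    + 0 ∎
    where
    open ≡-Reasoning
    E : Fin (suc (suc n)) → Fin (suc n) → ℤ
    E j k = det n (minor (minor M j) k)
    G : Fin (suc (suc n)) → Fin (suc n) → ℤ
    G j k = sign (toℕ j) * (M zero j * (sign (toℕ k) * (M (suc zero) (punchIn j k) * E j k)))
    cancel : ∀ s t x y e → s * (x * (t * (y * e))) + (- t) * (y * (s * (x * e))) ≡ + 0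
    cancel = solve-∀
    anti : ∀ a b → a Fin.≤ b → G (inject₁ a) b + G (suc b) a ≡ + 0
    anti a b a≤b
      -- After the rewrites both terms share entries and minor; the sign at `suc b` supplies the
      -- minus.
      rewrite toℕ-inject₁ a | punchIn-inject₁-≤ a≤b | punchIn-suc-≤ a≤b
            | sym (M₀≡M₁ (suc b)) | sym (M₀≡M₁ (inject₁ a))
            | det-cong {M = minor (minor M (inject₁ a)) b} {M′ = minor (minor M (suc b)) a}
                (λ i c → cong (M (suc (suc i))) (punchIn-punchIn-≤ a≤b c))
      = cancel (sign (toℕ a)) (sign (toℕ b)) (M zero (inject₁ a)) (M zero (suc b)) (E (suc b) a)

  alternating-suc : ∀ {n} {r s : Fin n} → Alternating r s → Alternating (suc r) (suc s)
  alternating-suc {n} alt M eq = trans (det-expand n M) (sum-zero _ (λ j →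
    trans (cong (λ x → sign (toℕ j) * (M zero j * x)) (alt (minor M j) (λ b → eq (punchIn j b))))
    (trans (cong (sign (toℕ j) *_) (*-zeroʳ (M zero j))) (*-zeroʳ (sign (toℕ j))))))

  -- Row `suc s` is swapped into position 1, next to the equal row 0. The swap avoids row 0, so its
  -- antisymmetry comes from the alternating property of the minors.
  alternating-zero : ∀ {n} → (∀ (r s : Fin n) → r ≢ s → Alternating r s) →
    ∀ (s : Fin n) → Alternating zero (suc s)
  alternating-zero alt zero M eq = alternating₀₁ M eq
  alternating-zero {n} alt (suc s) M eq = begin
    det (suc n) M
      ≡⟨ det-cong unchanged ⟨
    det (suc n) (M [ one ]≔ M one [ t ]≔ M t)
      ≡⟨ alternating⇒antisym (λ ()) (alternating-suc (alt zero (suc s) (λ ()))) M (M one) (M t) ⟩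
    - det (suc n) (M [ one ]≔ M t [ t ]≔ M one)
      ≡⟨ cong -_ (alternating₀₁ (M [ one ]≔ M t [ t ]≔ M one) eq) ⟩
    + 0 ∎
    where
    open ≡-Reasoning
    one t : Fin (suc n)
    one = suc zero
    t   = suc (suc s)
    unchanged : ∀ i j → (M [ one ]≔ M one [ t ]≔ M t) i j ≡ M i j
    unchanged i j = trans
      (≔-self (M [ one ]≔ M one) t (λ j → sym (≔-self M one (λ _ → refl) t j)) i j)
      (≔-self M one (λ _ → refl) i j)

  -- Induction on the size: pairs that avoid row 0 are settled in the minors, and pairs that contain
  -- it use every pair one size down.
  det-alternating : ∀ {n} (r s : Fin n) → r ≢ s → Alternating r s
  det-alternating zero    zero    r≢s = contradiction refl r≢s
  det-alternating zero    (suc s) r≢s = alternating-zero det-alternating s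
  det-alternating (suc r) zero    r≢s = λ M eq → alternating-zero det-alternating r M (sym ∘ eq)
  det-alternating (suc r) (suc s) r≢s = alternating-suc (det-alternating r s (r≢s ∘ cong suc))

-- The determinant with rows `e_x + e_{f x}`, by elimination along the cycles of `f`.

module CycleElimination where

  open Determinant
  open import Data.Nat as ℕ using (ℕ; zero; suc; z≤n; s≤s; _∸_; _≡ᵇ_; _^_)
  import Data.Nat.Properties as ℕ
  open import Data.Nat.GeneralisedArithmetic using (fold; fold-+)
  open import Data.Bool using (Bool; true; false; if_then_else_; _∨_)
  open import Data.Bool.Properties using (¬-not)
  open import Data.Fin as Fin using (Fin; zero; suc; toℕ)
  open import Data.Integer using (ℤ; +_; -_; _+_; _*_)
  open import Data.Integer.Properties
  open import Data.List using (List; []; _∷_; length; allFin)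
  open import Data.List.Membership.Propositional using (_∈_)
  open import Data.List.Membership.Propositional.Properties using (∈-allFin)
  open import Data.List.Relation.Unary.Any using (here; there)
  open import Data.List.Relation.Unary.All as All using (All; []; _∷_)
  open import Data.List.Relation.Unary.AllPairs using ([]; _∷_)
  open import Data.List.Relation.Unary.Unique.Propositional using (Unique)
  open import Data.Product using (_×_; _,_; proj₁; proj₂; ∃)
  open import Data.Sum using (_⊎_; inj₁; inj₂)
  open import Function using (_∘_)
  open import Relation.Nullary using (yes; no; does; contradiction)
  open import Relation.Binary.PropositionalEquality

  -- A cycle of length `suc k` ends its alternating sum on the sign with index `k`.
  sign-odd : ∀ k → IsOdd (suc k) → sign k ≡ + 1
  sign-odd zero          odd = refl
  sign-odd (suc (suc k)) odd = trans (neg-involutive (sign k)) (sign-odd k odd)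

  sign-even : ∀ k → IsEven (suc k) → sign k ≡ - (+ 1)
  sign-even (suc zero)    even = refl
  sign-even (suc (suc k)) even = trans (neg-involutive (sign k)) (sign-even k even)

  -- The standard basis row, written with the Boolean test on `toℕ` that occurs in `C`.
  δ : ∀ {n} → Fin n → Fin n → ℤ
  δ x j = 𝟙 (toℕ x ≡ᵇ toℕ j)

  record Period {A : Set} (f : A → A) (k : ℕ) (x : A) : Set where
    field
      closes  : fold x f k ≡ x
      minimal : ∀ i → 0 ℕ.< i → i ℕ.< k → fold x f i ≢ x

  Region : ℕ → Set
  Region n = Fin n → Bool

  insert : ∀ {n} → Fin n → Region n → Region n
  insert x S y = does (y Fin.≟ x) ∨ S y

  module _ {n : ℕ} {x : Fin n} {S : Region n} where

    insert-here : insert x S x ≡ true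
    insert-here with x Fin.≟ x
    ... | yes _  = refl
    ... | no x≢x = contradiction refl x≢x

    insert-there : ∀ {y} → S y ≡ true → insert x S y ≡ true
    insert-there {y} Sy with y Fin.≟ x
    ... | yes _ = refl
    ... | no _  = Sy

    insert-≢ : ∀ {y} → y ≢ x → insert x S y ≡ S y
    insert-≢ {y} y≢x with y Fin.≟ x
    ... | yes y≡x = contradiction y≡x y≢x
    ... | no _    = refl

    insert⁻ : ∀ {y} → insert x S y ≡ true → y ≡ x ⊎ S y ≡ true
    insert⁻ {y} in-y with y Fin.≟ x
    ... | yes y≡x = inj₁ y≡x
    ... | no _    = inj₂ in-y

  absent : Bool → ℕ
  absent b = if b then 0 else 1

  -- Measures what is still to be eliminated from a list; its drop over a whole class determines the
  -- number of cycles there.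
  count : ∀ {n} → List (Fin n) → Region n → ℕ
  count []      S = 0
  count (a ∷ A) S = absent (S a) ℕ.+ count A S

  module _ {n : ℕ} {S : Region n} where

    count-insert-∉ : ∀ {A y} → All (y ≢_) A → count A (insert y S) ≡ count A S
    count-insert-∉ []                = refl
    count-insert-∉ (y≢a ∷ y∉A) =
      cong₂ (λ b c → absent b ℕ.+ c) (insert-≢ {S = S} (y≢a ∘ sym)) (count-insert-∉ y∉A)

    count-insert-∈ : ∀ {A y} → Unique A → y ∈ A → S y ≡ false →
      count A S ≡ suc (count A (insert y S))
    count-insert-∈ {a ∷ A} (a∉A ∷ _) (here refl) Sa = begin
      absent (S a) ℕ.+ count A S                             ≡⟨ cong₂ (λ b c → absent b ℕ.+ c) Sa (sym (count-insert-∉ a∉A)) ⟩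
      suc (count A (insert a S))                                ≡⟨ cong (λ b → suc (absent b ℕ.+ count A (insert a S))) (insert-here {x = a} {S}) ⟨
      suc (absent (insert a S a) ℕ.+ count A (insert a S)) ∎
      where open ≡-Reasoning
    count-insert-∈ {a ∷ A} {y} (a∉A ∷ uniq) (there y∈A) Sy = begin
      absent (S a) ℕ.+ count A S                             ≡⟨ cong₂ (λ b c → absent b ℕ.+ c) (sym (insert-≢ {x = y} {S} (All.lookup a∉A y∈A))) (count-insert-∈ uniq y∈A Sy) ⟩
      absent (insert y S a) ℕ.+ suc (count A (insert y S))   ≡⟨ ℕ.+-suc (absent (insert y S a)) _ ⟩
      suc (absent (insert y S a) ℕ.+ count A (insert y S)) ∎
      where open ≡-Reasoning

    count-full : ∀ {A} → (∀ {y} → y ∈ A → S y ≡ true) → count A S ≡ 0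
    count-full {[]}    full = refl
    count-full {a ∷ A} full rewrite full {a} (here refl) = count-full (full ∘ there)

    count-empty : ∀ {A} → (∀ {y} → y ∈ A → S y ≡ false) → count A S ≡ length A
    count-empty {[]}    empty = refl
    count-empty {a ∷ A} empty rewrite empty {a} (here refl) = cong suc (count-empty (empty ∘ there))

  module Elimination {n : ℕ} (p π f : Fin n → Fin n)
    (p∘π : ∀ x → p (π x) ≡ x) (π∘p : ∀ i → π (p i) ≡ i) where

    row : Region n → Fin n → Fin n → ℤ
    row S x j = δ x j + (if S x then + 0 else δ (f x) j)

    D : Region n → ℤ
    D S = det n (λ i → row S (p i))

    -- The determinant as a function of the row that belongs to `x`; this row stands at index `π x`.
    V : Region n → Fin n → (Fin n → ℤ) → ℤ
    V S x v = det n ((λ i → row S (p i)) [ π x ]≔ v)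

    D-cong : ∀ {S S′} → (∀ x → S x ≡ S′ x) → D S ≡ D S′
    D-cong eq = det-cong (λ i j → cong (λ b → δ (p i) j + (if b then + 0 else δ (f (p i)) j)) (eq (p i)))

    row-in : ∀ {S x} → S x ≡ true → ∀ j → row S x j ≡ δ x j
    row-in {x = x} Sx j rewrite Sx = +-identityʳ (δ x j)

    row-out : ∀ {S x} → S x ≡ false → ∀ j → row S x j ≡ δ x j + δ (f x) j
    row-out Sx j rewrite Sx = refl

    -- The row belonging to `x` is overwritten, so agreement of the regions away from `x` is enough.
    V-cong : ∀ {S S′ x v v′} → (∀ y → y ≢ x → S y ≡ S′ y) → (∀ j → v j ≡ v′ j) → V S x v ≡ V S′ x v′
    V-cong {S} {S′} {x} S≡ v≡ = det-cong eq
      where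
      eq : ∀ i j → ((λ i → row S (p i)) [ π x ]≔ _) i j ≡ ((λ i → row S′ (p i)) [ π x ]≔ _) i j
      eq i j with i Fin.≟ π x
      ... | yes refl = trans (≔-hit _ (π x) j) (trans (v≡ j) (sym (≔-hit _ (π x) j)))
      ... | no i≢πx  = trans (≔-miss _ (π x) i≢πx j) (trans
        (cong (λ b → δ (p i) j + (if b then + 0 else δ (f (p i)) j))
          (S≡ (p i) (λ pi≡x → i≢πx (trans (sym (π∘p i)) (cong π pi≡x)))))
        (sym (≔-miss _ (π x) i≢πx j)))

    D≡V : ∀ S x → D S ≡ V S x (row S x)
    D≡V S x = sym (det-cong (≔-self _ (π x) (λ j → cong (λ y → row S y j) (sym (p∘π x)))))

    D-insert : ∀ S x → D (insert x S) ≡ V S x (δ x)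
    D-insert S x = trans (D≡V (insert x S) x)
      (V-cong (λ y y≢x → insert-≢ {x = x} {S} y≢x) (row-in {insert x S} (insert-here {x = x} {S})))

    V-split : ∀ {S y} x → S y ≡ false → V S x (row S y) ≡ V S x (δ y) + V S x (δ (f y))
    V-split {S} x Sy = det-≔-+ _ (π x) (row-out {S} Sy)

    V-row : ∀ S {x y} → x ≢ y → V S x (row S y) ≡ + 0
    V-row S {x} {y} x≢y = det-alternating (π x) (π y) πx≢πy _ (λ j →
      trans (≔-hit _ (π x) j) (sym (trans (≔-miss _ (π x) (πx≢πy ∘ sym) j) (cong (λ z → row S z j) (p∘π y)))))
      where
      πx≢πy : π x ≢ π y
      πx≢πy eq = x≢y (trans (sym (p∘π x)) (trans (cong p eq) (p∘π y)))

    -- Splitting the row of `x` leaves `D (insert x S)` and a determinant with `e_{f x}` in that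
    -- place. The latter repeats the reduced row of `f x` and vanishes.
    absorb : ∀ {S x} → S (f x) ≡ true → D S ≡ D (insert x S)
    absorb {S} {x} Sfx with S x in Sx
    ... | true  = D-cong same
      where
      same : ∀ y → S y ≡ insert x S y
      same y with y Fin.≟ x
      ... | yes refl = Sx
      ... | no _     = refl
    ... | false = begin
      D S                             ≡⟨ D≡V S x ⟩
      V S x (row S x)                 ≡⟨ V-split {S} x Sx ⟩
      V S x (δ x) + V S x (δ (f x))   ≡⟨ cong₂ _+_ (D-insert S x) (V-cong {S} {S} (λ _ _ → refl) (row-in {S} Sfx)) ⟨
      D (insert x S) + V S x (row S (f x)) ≡⟨ cong (λ z → D (insert x S) + z) (V-row S x≢fx) ⟩
      D (insert x S) + + 0            ≡⟨ +-identityʳ _ ⟩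
      D (insert x S) ∎
      where
      open ≡-Reasoning
      x≢fx : x ≢ f x
      x≢fx x≡fx with () ← trans (sym Sx) (trans (cong S x≡fx) Sfx)

    -- A copy of the row `e_y + e_{f y}` in the place of `x` gives zero, so in that place `e_{f y}`
    -- counts as minus `e_y`.
    V-step : ∀ {S x y} → x ≢ y → S y ≡ false → V S x (δ (f y)) ≡ - V S x (δ y)
    V-step {S} {x} {y} x≢y Sy = inverse-unique _ _
      (trans (+-comm _ (V S x (δ y))) (trans (sym (V-split {S} x Sy)) (V-row S x≢y)))

    module _ {S : Region n} {k : ℕ} {x : Fin n} (per : Period f (suc k) x) (avoid : ∀ i → i ℕ.≤ suc k → S (fold x f i) ≡ false) where
      open Period per

      V-walk : ∀ i → i ℕ.≤ k → V S x (δ (fold x f (suc i))) ≡ sign i * V S x (δ (f x))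
      V-walk zero    _   = sym (*-identityˡ _)
      V-walk (suc i) i<k = begin
        V S x (δ (f (fold x f (suc i)))) ≡⟨ V-step {S} (minimal (suc i) (s≤s z≤n) (s≤s i<k) ∘ sym) (avoid (suc i) (ℕ.m≤n⇒m≤1+n i<k)) ⟩
        - V S x (δ (fold x f (suc i)))   ≡⟨ cong -_ (V-walk i (ℕ.<⇒≤ i<k)) ⟩
        - (sign i * V S x (δ (f x)))     ≡⟨ neg-distribˡ-* (sign i) _ ⟩
        - sign i * V S x (δ (f x)) ∎
        where open ≡-Reasoning

      -- Rₓ - R_{f x} + R_{f² x} - ... telescopes around the cycle.
      D-cycle : D S ≡ sign k * V S x (δ (f x)) + V S x (δ (f x))
      D-cycle = begin
        D S                                          ≡⟨ D≡V S x ⟩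
        V S x (row S x)                              ≡⟨ V-split {S} x (avoid 0 z≤n) ⟩
        V S x (δ x) + V S x (δ (f x))                ≡⟨ cong (λ y → V S x (δ y) + V S x (δ (f x))) closes ⟨
        V S x (δ (fold x f (suc k))) + V S x (δ (f x)) ≡⟨ cong (λ z → z + V S x (δ (f x))) (V-walk k ℕ.≤-refl) ⟩
        sign k * V S x (δ (f x)) + V S x (δ (f x)) ∎
        where open ≡-Reasoning

      even-cycle : IsEven (suc k) → D S ≡ + 0
      even-cycle even = trans D-cycle (trans
        (cong (λ s → s * V S x (δ (f x)) + V S x (δ (f x))) (sign-even k even))
        (trans (cong (λ z → z + V S x (δ (f x))) (-1*i≡-i (V S x (δ (f x))))) (+-inverseˡ (V S x (δ (f x))))))

      -- Walking once around an odd cycle identifies the contributions of `e_x` and `e_{f x}`, and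
      -- each of them is `D (insert x S)`.
      odd-cycle : IsOdd (suc k) → D S ≡ + 2 * D (insert x S)
      odd-cycle odd = begin
        D S                                        ≡⟨ D-cycle ⟩
        sign k * V S x (δ (f x)) + V S x (δ (f x)) ≡⟨ cong (λ s → s * V S x (δ (f x)) + V S x (δ (f x))) (sign-odd k odd) ⟩
        + 1 * V S x (δ (f x)) + V S x (δ (f x))    ≡⟨ cong (λ z → z + V S x (δ (f x))) (*-identityˡ (V S x (δ (f x)))) ⟩
        V S x (δ (f x)) + V S x (δ (f x))          ≡⟨ cong₂ _+_ same same ⟨
        D (insert x S) + D (insert x S)            ≡⟨ cong₂ _+_ (*-identityˡ (D (insert x S))) (*-identityˡ (D (insert x S))) ⟨
        + 1 * D (insert x S) + + 1 * D (insert x S) ≡⟨ *-distribʳ-+ (D (insert x S)) (+ 1) (+ 1) ⟨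
        + 2 * D (insert x S) ∎
        where
        open ≡-Reasoning
        same : D (insert x S) ≡ V S x (δ (f x))
        same = begin
          D (insert x S)               ≡⟨ D-insert S x ⟩
          V S x (δ x)                  ≡⟨ cong (λ y → V S x (δ y)) closes ⟨
          V S x (δ (fold x f (suc k))) ≡⟨ V-walk k ℕ.≤-refl ⟩
          sign k * V S x (δ (f x))     ≡⟨ cong (_* V S x (δ (f x))) (sign-odd k odd) ⟩
          + 1 * V S x (δ (f x))        ≡⟨ *-identityˡ _ ⟩
          V S x (δ (f x)) ∎

    -- Filling in whole cycles, then the paths that lead into them.

    Closed : Region n → Set
    Closed S = ∀ x → S x ≡ true → S (f x) ≡ true

    closed-fold : ∀ {S} → Closed S → ∀ {x} i → S x ≡ true → S (fold x f i) ≡ true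
    closed-fold closed zero    Sx = Sx
    closed-fold closed (suc i) Sx = closed _ (closed-fold closed i Sx)

    module Orbit {S : Region n} {k : ℕ} {x : Fin n} (closed : Closed S) (per : Period f (suc k) x)
      (odd : IsOdd (suc k)) (x∉S : S x ≡ false) where
      open Period per

      -- An iterate inside the closed region would carry the rest of the cycle, and finally `x`,
      -- into it.
      avoid : ∀ i → i ℕ.≤ suc k → S (fold x f i) ≡ false
      avoid i i≤k = ¬-not λ Sfⁱ → case-⊥ (trans (sym x∉S) (trans
        (cong S (trans (sym closes) (trans (cong (fold x f) (sym (ℕ.m∸n+n≡m i≤k))) (fold-+ x f (suc k ∸ i)))))
        (closed-fold closed (suc k ∸ i) Sfⁱ)))
        where
        case-⊥ : false ≢ true
        case-⊥ ()

      -- The cycle is listed backwards from `x`, so that `f` sends each new point to the one before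
      -- it, as `absorb` requires.
      back : ℕ → Fin n
      back t = fold x f (suc k ∸ t)

      f-back : ∀ {t} → t ℕ.≤ k → f (back (suc t)) ≡ back t
      f-back {t} t≤k = cong (fold x f) (sym (ℕ.+-∸-assoc 1 t≤k))

      -- Applying `f` another `s` times to a coincidence would bring `x` back to itself after a
      -- positive number of steps below `suc k`.
      back-distinct : ∀ {s t} → s ℕ.< t → t ℕ.≤ k → back t ≢ back s
      back-distinct {s} {t} s<t t≤k eq = minimal (s ℕ.+ (suc k ∸ t))
        (ℕ.≤-trans (ℕ.m<n⇒0<n∸m (s≤s t≤k)) (ℕ.m≤n+m _ s))
        (ℕ.<-≤-trans (ℕ.+-monoˡ-< (suc k ∸ t) s<t) (ℕ.≤-reflexive (ℕ.m+[n∸m]≡n (ℕ.m≤n⇒m≤1+n t≤k))))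
        (begin
          fold x f (s ℕ.+ (suc k ∸ t))  ≡⟨ fold-+ x f s ⟩
          fold (back t) f s             ≡⟨ cong (λ y → fold y f s) eq ⟩
          fold (back s) f s             ≡⟨ fold-+ x f s ⟨
          fold x f (s ℕ.+ (suc k ∸ s))  ≡⟨ cong (fold x f) (ℕ.m+[n∸m]≡n (ℕ.≤-trans (ℕ.<⇒≤ s<t) (ℕ.m≤n⇒m≤1+n t≤k))) ⟩
          fold x f (suc k)              ≡⟨ closes ⟩
          x ∎)
        where open ≡-Reasoning

      filled : ℕ → Region n
      filled zero    = S
      filled (suc t) = insert (back t) (filled t)

      filled⁻ : ∀ t {y} → filled t y ≡ true → S y ≡ true ⊎ ∃ λ s → s ℕ.< t × y ≡ back s
      filled⁻ zero    in-y = inj₁ in-y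
      filled⁻ (suc t) in-y with insert⁻ {x = back t} {filled t} in-y
      ... | inj₁ y≡ = inj₂ (t , ℕ.≤-refl , y≡)
      ... | inj₂ in-y′ with filled⁻ t in-y′
      ...   | inj₁ Sy             = inj₁ Sy
      ...   | inj₂ (s , s<t , y≡) = inj₂ (s , ℕ.m≤n⇒m≤1+n s<t , y≡)

      filled-grows : ∀ t {y} → S y ≡ true → filled t y ≡ true
      filled-grows zero    Sy = Sy
      filled-grows (suc t) Sy = insert-there {x = back t} {filled t} (filled-grows t Sy)

      filled-back : ∀ {s} t → s ℕ.< t → filled t (back s) ≡ true
      filled-back {s} (suc t) (s≤s s≤t) with s ℕ.≟ t
      ... | yes refl = insert-here {x = back t} {filled t}
      ... | no s≢t   = insert-there {x = back t} {filled t} (filled-back t (ℕ.≤∧≢⇒< s≤t s≢t))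

      filled-fresh : ∀ {t} → t ℕ.≤ k → filled t (back t) ≡ false
      filled-fresh {t} t≤k = ¬-not λ in-t → absurd (filled⁻ t in-t)
        where
        absurd : S (back t) ≡ true ⊎ (∃ λ s → s ℕ.< t × back t ≡ back s) → _
        absurd (inj₁ Sy) with () ← trans (sym (avoid (suc k ∸ t) (ℕ.m∸n≤m (suc k) t))) Sy
        absurd (inj₂ (s , s<t , eq)) = back-distinct s<t t≤k eq

      -- Only the first point costs a factor 2; every later one is absorbed.
      D-filled : ∀ t → t ℕ.≤ k → D S ≡ + 2 * D (filled (suc t))
      D-filled zero    _   = trans (odd-cycle {S} per avoid odd) (cong (λ y → + 2 * D (insert y S)) (sym closes))
      D-filled (suc t) t<k = trans (D-filled t (ℕ.<⇒≤ t<k)) (cong (+ 2 *_)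
        (absorb {filled (suc t)} (trans (cong (filled (suc t)) (f-back (ℕ.<⇒≤ t<k))) (filled-back (suc t) ℕ.≤-refl))))

      orbit : Region n
      orbit = filled (suc k)

      x∈orbit : orbit x ≡ true
      x∈orbit = trans (cong orbit (sym closes)) (filled-back (suc k) (s≤s z≤n))

      orbit-closed : Closed orbit
      orbit-closed y in-y with filled⁻ (suc k) in-y
      ... | inj₁ Sy = filled-grows (suc k) (closed y Sy)
      ... | inj₂ (suc s , s<k , refl) =
        trans (cong orbit (f-back (ℕ.≤-pred (ℕ.<⇒≤ s<k)))) (filled-back (suc k) (ℕ.<⇒≤ s<k))
      -- Here the point is `x` itself, and `f x` is the last point listed, `back k`.
      ... | inj₂ (zero , _ , refl) = trans (cong (orbit ∘ f) closes)
        (trans (cong (λ i → orbit (fold x f i)) (sym (ℕ.m+n∸n≡m 1 k))) (filled-back (suc k) ℕ.≤-refl))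

      count-filled : ∀ {A} → Unique A → (∀ i → fold x f i ∈ A) → ∀ t → t ℕ.≤ suc k →
        count A S ≡ t ℕ.+ count A (filled t)
      count-filled uniq orbit⊆A zero    _         = refl
      count-filled {A} uniq orbit⊆A (suc t) (s≤s t≤k) = begin
        count A S                       ≡⟨ count-filled uniq orbit⊆A t (ℕ.m≤n⇒m≤1+n t≤k) ⟩
        t ℕ.+ count A (filled t)            ≡⟨ cong (t ℕ.+_) (count-insert-∈ uniq (orbit⊆A (suc k ∸ t)) (filled-fresh t≤k)) ⟩
        t ℕ.+ suc (count A (filled (suc t))) ≡⟨ ℕ.+-suc t _ ⟩
        suc t ℕ.+ count A (filled (suc t)) ∎
        where open ≡-Reasoning

    -- The outcome of eliminating all cycles of length `k` that meet `L` within the class `A`. The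
    -- number of cycles newly filled is `e`; once `A` is exhausted, `size` expresses it through the
    -- length of `A`.
    record Doubling (A L : List (Fin n)) (k : ℕ) (S : Region n) : Set where
      field
        S′     : Region n
        e      : ℕ
        value  : D S ≡ + (2 ^ e) * D S′
        size   : count A S ≡ e ℕ.* k ℕ.+ count A S′
        closed : Closed S′
        grows  : ∀ {y} → S y ≡ true → S′ y ≡ true
        within : ∀ {y} → S′ y ≡ true → S y ≡ true ⊎ y ∈ A
        covers : ∀ {y} → y ∈ L → S′ y ≡ true

    module _ {A : List (Fin n)} {k : ℕ} (uniq : Unique A) (A-closed : ∀ {x} → x ∈ A → f x ∈ A)
      (periodic : ∀ {x} → x ∈ A → Period f (suc k) x) (odd : IsOdd (suc k)) where

      orbit⊆A : ∀ {x} → x ∈ A → ∀ i → fold x f i ∈ A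
      orbit⊆A x∈A zero    = x∈A
      orbit⊆A x∈A (suc i) = A-closed (orbit⊆A x∈A i)

      -- A point already in the region is skipped; for any other point the whole cycle is adjoined,
      -- which accounts for one factor 2 and `suc k` elements of `A`.
      eliminate : ∀ L → (∀ {x} → x ∈ L → x ∈ A) → ∀ {S} → Closed S → Doubling A L (suc k) S
      eliminate [] L⊆A {S} S-closed = record
        { S′ = S ; e = 0 ; value = sym (*-identityˡ (D S)) ; size = refl ; closed = S-closed
        ; grows = λ Sy → Sy ; within = inj₁ ; covers = λ () }
      eliminate (x ∷ L) L⊆A {S} S-closed with S x in Sx
      ... | true  = record
        { S′ = S′ ; e = e ; value = value ; size = size ; closed = closed
        ; grows = grows ; within = within ; covers = λ { (here refl) → grows Sx ; (there y∈L) → covers y∈L } }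
        where open Doubling (eliminate L (L⊆A ∘ there) S-closed)
      ... | false = record
        { S′ = S′ ; e = suc e
        ; value = begin
            D S                              ≡⟨ D-filled k ℕ.≤-refl ⟩
            + 2 * D orbit                    ≡⟨ cong (+ 2 *_) value ⟩
            + 2 * (+ (2 ^ e) * D S′)         ≡⟨ *-assoc (+ 2) (+ (2 ^ e)) (D S′) ⟨
            (+ 2 * + (2 ^ e)) * D S′         ≡⟨ cong (_* D S′) (pos-* 2 (2 ^ e)) ⟨
            + (2 ^ suc e) * D S′ ∎
        ; size = begin
            count A S                              ≡⟨ count-filled uniq (orbit⊆A x∈A) (suc k) ℕ.≤-refl ⟩
            suc k ℕ.+ count A orbit                ≡⟨ cong (suc k ℕ.+_) size ⟩
            suc k ℕ.+ (e ℕ.* suc k ℕ.+ count A S′) ≡⟨ ℕ.+-assoc (suc k) (e ℕ.* suc k) (count A S′) ⟨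
            suc e ℕ.* suc k ℕ.+ count A S′ ∎
        ; closed = closed
        ; grows  = grows ∘ filled-grows (suc k)
        ; within = within′
        ; covers = λ { (here refl) → grows x∈orbit ; (there y∈L) → covers y∈L } }
        where
        open ≡-Reasoning
        x∈A : x ∈ A
        x∈A = L⊆A (here refl)
        open Orbit {S} S-closed (periodic x∈A) odd Sx
        open Doubling (eliminate L (L⊆A ∘ there) orbit-closed)
        within′ : ∀ {y} → S′ y ≡ true → S y ≡ true ⊎ y ∈ A
        within′ S′y with within S′y
        ... | inj₂ y∈A = inj₂ y∈A
        ... | inj₁ in-orbit with filled⁻ (suc k) in-orbit
        ...   | inj₁ Sy              = inj₁ Sy
        ...   | inj₂ (s , _ , refl)  = inj₂ (orbit⊆A x∈A (suc k ∸ s))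

    record Absorbing (L : List (Fin n)) (S : Region n) : Set where
      field
        S′     : Region n
        value  : D S ≡ D S′
        grows  : ∀ {y} → S y ≡ true → S′ y ≡ true
        covers : ∀ {y} → y ∈ L → S′ y ≡ true

    -- Points are inserted from the far end of the path back to `x`, so the image of each is present
    -- beforehand.
    absorb-path : ∀ j {x S} → S (fold x f j) ≡ true → Absorbing (x ∷ []) S
    absorb-path zero    {S = S} Sx = record
      { S′ = S ; value = refl ; grows = λ Sy → Sy ; covers = λ { (here refl) → Sx } }
    absorb-path (suc j) {x} {S} Sx = record
      { S′ = S′ ; value = trans (absorb {S} Sx) value ; grows = grows ∘ insert-there {x = fold x f j} {S} ; covers = covers }
      where open Absorbing (absorb-path j {x} {insert (fold x f j) S} (insert-here {x = fold x f j} {S}))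

    absorb-list : ∀ L {S} → (∀ x → ∃ λ j → S (fold x f j) ≡ true) → Absorbing L S
    absorb-list []      {S} reach = record { S′ = S ; value = refl ; grows = λ Sy → Sy ; covers = λ () }
    absorb-list (x ∷ L) {S} reach = record
      { S′ = B.S′ ; value = trans A.value B.value ; grows = B.grows ∘ A.grows
      ; covers = λ { (here refl) → B.grows (A.covers (here refl)) ; (there y∈L) → B.covers y∈L } }
      where
      module A = Absorbing (absorb-path (proj₁ (reach x)) {x} {S} (proj₂ (reach x)))
      module B = Absorbing (absorb-list L {A.S′} (λ y → proj₁ (reach y) , A.grows (proj₂ (reach y))))

    -- When every path runs into `S`, all rows reduce to unit rows and the permutation matrix of `p`
    -- remains.
    absorb-all : ∀ {S} → (∀ x → ∃ λ j → S (fold x f j) ≡ true) → D S ≡ det n (λ i → δ (p i))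
    absorb-all {S} reach = trans value (det-cong (λ i → row-in {S′} (covers (∈-allFin (p i)))))
      where open Absorbing (absorb-list (allFin n) {S} reach)

-- The sign of the permutation that halves modulo `2m + 1`.

module HalvingPermutation where

  open Determinant
  open CycleElimination
  open import Data.Nat as ℕ using (ℕ; zero; suc; z≤n; s≤s; _≡ᵇ_)
  import Data.Nat.Properties as ℕ
  open import Data.Fin as Fin using (Fin; zero; suc; toℕ; fromℕ<; punchIn)
  open import Data.Fin.Properties using (toℕ-fromℕ<; toℕ<n; toℕ-injective)
  open import Data.Integer using (ℤ; +_; -_; _+_; _*_)
  open import Data.Integer.Properties
  open import Data.Integer.Tactic.RingSolver using (solve-∀)
  open import Algebra.Properties.Semiring.Sum +-*-semiring using (sum)
  open import Data.Product using (_×_; _,_)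
  open import Data.Sum using (_⊎_; inj₁; inj₂)
  open import Function using (_∘_)
  open import Relation.Nullary.Decidable using (dec-true; dec-false)
  open import Relation.Binary.PropositionalEquality

  sum-single : ∀ {n} (c : Fin n) (g : Fin n → ℤ) → (∀ j → j ≢ c → g j ≡ + 0) → sum g ≡ g c
  sum-single zero    g off = trans (cong (λ z → g zero + z) (sum-zero (g ∘ suc) (λ j → off (suc j) (λ ())))) (+-identityʳ (g zero))
  sum-single (suc c) g off = trans
    (cong₂ _+_ (off zero (λ ())) (sum-single c (g ∘ suc) (λ j j≢c → off (suc j) (λ { refl → j≢c refl }))))
    (+-identityˡ (g (suc c)))

  δ-same : ∀ {n} (c : Fin n) → δ c c ≡ + 1
  δ-same c = cong 𝟙 (dec-true (toℕ c ℕ.≟ toℕ c) refl)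

  δ-diff : ∀ {n} {c j : Fin n} → j ≢ c → δ c j ≡ + 0
  δ-diff {c = c} {j} j≢c = cong 𝟙 (dec-false (toℕ c ℕ.≟ toℕ j) (j≢c ∘ sym ∘ toℕ-injective))

  det-unit-row : ∀ {n} (M : Matrix (suc n)) c → (∀ j → M zero j ≡ δ c j) →
    det (suc n) M ≡ sign (toℕ c) * det n (minor M c)
  det-unit-row {n} M c M₀≡δ = begin
    det (suc n) M                                        ≡⟨ det-expand n M ⟩
    sum (cofactorTerm M)                                 ≡⟨ sum-single c (cofactorTerm M) off ⟩
    sign (toℕ c) * (M zero c * det n (minor M c))        ≡⟨ cong (λ x → sign (toℕ c) * (x * det n (minor M c))) (trans (M₀≡δ c) (δ-same c)) ⟩
    sign (toℕ c) * (+ 1 * det n (minor M c))             ≡⟨ cong (sign (toℕ c) *_) (*-identityˡ (det n (minor M c))) ⟩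
    sign (toℕ c) * det n (minor M c) ∎
    where
    open ≡-Reasoning
    off : ∀ j → j ≢ c → cofactorTerm M j ≡ + 0
    off j j≢c = trans (cong (λ x → sign (toℕ j) * (x * det n (minor M j))) (trans (M₀≡δ j) (δ-diff j≢c)))
      (*-zeroʳ (sign (toℕ j)))

  -- Defined by recursion so that sizes such as `suc (double (suc m))` expose two successors by
  -- computation.
  double : ℕ → ℕ
  double zero    = zero
  double (suc m) = suc (suc (double m))

  double≡+ : ∀ m → double m ≡ m ℕ.+ m
  double≡+ zero    = refl
  double≡+ (suc m) = cong suc (trans (cong suc (double≡+ m)) (sym (ℕ.+-suc m m)))

  double-cancel-≤ : ∀ {a b} → double a ℕ.≤ double b → a ℕ.≤ b
  double-cancel-≤ {zero}          _             = z≤n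
  double-cancel-≤ {suc a} {suc b} (s≤s (s≤s le)) = s≤s (double-cancel-≤ le)

  -- i / 2 modulo 2 m + 1, for 0 ≤ i ≤ 2 m.
  halve : ℕ → ℕ → ℕ
  halve m zero          = zero
  halve m (suc zero)    = suc m
  halve m (suc (suc i)) = suc (halve m i)

  -- The first alternative is an even `i`, whose half is independent of the modulus; the second is
  -- an odd `i`, whose half `(i + 2m + 1) / 2` moves up with `m`.
  HalveView : ℕ → ℕ → Set
  HalveView m i =
      (halve (suc m) i ≡ halve m i × double (halve m i) ≡ i)
    ⊎ (halve (suc m) i ≡ suc (halve m i) × suc m ℕ.≤ halve m i × double (halve m i) ≡ i ℕ.+ suc (double m))

  halveView : ∀ m i → HalveView m i
  halveView m zero       = inj₁ (refl , refl)
  halveView m (suc zero) = inj₂ (refl , ℕ.≤-refl , refl)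
  halveView m (suc (suc i)) with halveView m i
  ... | inj₁ (eq , dbl)      = inj₁ (cong suc eq , cong (2 ℕ.+_) dbl)
  ... | inj₂ (eq , le , dbl) = inj₂ (cong suc eq , ℕ.m≤n⇒m≤1+n le , cong (2 ℕ.+_) dbl)

  punchIn-≡ᵇ-< : ∀ {n} (c : Fin (suc n)) (b : Fin n) {v} → v ℕ.< toℕ c →
    (v ≡ᵇ toℕ (punchIn c b)) ≡ (v ≡ᵇ toℕ b)
  punchIn-≡ᵇ-< (suc c) zero            v<c       = refl
  punchIn-≡ᵇ-< (suc c) (suc b) {zero}  v<c       = refl
  punchIn-≡ᵇ-< (suc c) (suc b) {suc v} (s≤s v<c) = punchIn-≡ᵇ-< c b v<c

  punchIn-≡ᵇ-≥ : ∀ {n} (c : Fin (suc n)) (b : Fin n) {v} → toℕ c ℕ.≤ v →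
    (suc v ≡ᵇ toℕ (punchIn c b)) ≡ (v ≡ᵇ toℕ b)
  punchIn-≡ᵇ-≥ zero    b               c≤v       = refl
  punchIn-≡ᵇ-≥ (suc c) zero    {suc v} c≤v       = refl
  punchIn-≡ᵇ-≥ (suc c) (suc b) {suc v} (s≤s c≤v) = punchIn-≡ᵇ-≥ c b c≤v

  Halving : ∀ m → Matrix (suc (double m))
  Halving m i j = 𝟙 (halve m (toℕ i) ≡ᵇ toℕ j)

  m≤double : ∀ m → m ℕ.≤ double m
  m≤double m = ℕ.≤-trans (ℕ.m≤m+n m m) (ℕ.≤-reflexive (sym (double≡+ m)))

  -- Deleting rows 0 and 1 with the columns of their unit entries leaves the halving matrix of the
  -- modulus smaller by 2.
  det-Halving-suc : ∀ m → det _ (Halving (suc m)) ≡ sign (suc m) * det _ (Halving m)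
  det-Halving-suc m = begin
    det _ (Halving (suc m))        ≡⟨ det-unit-row (Halving (suc m)) zero (λ _ → refl) ⟩
    + 1 * det _ M₁                 ≡⟨ *-identityˡ (det _ M₁) ⟩
    det _ M₁                       ≡⟨ det-unit-row M₁ c (λ j → cong (λ v → 𝟙 (v ≡ᵇ toℕ j)) (sym toℕ-c)) ⟩
    sign (toℕ c) * det _ (minor M₁ c) ≡⟨ cong₂ (λ v d → sign v * d) toℕ-c (det-cong (λ a b → cong 𝟙 (entry a b))) ⟩
    sign (suc m) * det _ (Halving m) ∎
    where
    open ≡-Reasoning
    M₁ : Matrix (suc (suc (double m)))
    M₁ = minor (Halving (suc m)) zero
    -- Modulo `2m + 3` half of 1 is `m + 2`, which becomes column `m + 1` once column 0 is deleted.
    c : Fin (suc (suc (double m)))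
    c = fromℕ< (s≤s (s≤s (m≤double m)))
    toℕ-c : toℕ c ≡ suc m
    toℕ-c = toℕ-fromℕ< (s≤s (s≤s (m≤double m)))
    entry : ∀ (a b : Fin (suc (double m))) →
      (halve (suc m) (toℕ a) ≡ᵇ toℕ (punchIn c b)) ≡ (halve m (toℕ a) ≡ᵇ toℕ b)
    entry a b with halveView m (toℕ a)
    -- Halves of even indices lie to the left of the deleted column.
    ... | inj₁ (eq , dbl) rewrite eq = punchIn-≡ᵇ-< c b
      (subst (halve m (toℕ a) ℕ.<_) (sym toℕ-c)
        (s≤s (double-cancel-≤ (subst (ℕ._≤ double m) (sym dbl) (ℕ.≤-pred (toℕ<n a))))))
    -- Halves of odd indices lie to its right, where the deletion undoes the shift by one.
    ... | inj₂ (eq , le , _) rewrite eq = punchIn-≡ᵇ-≥ c b (subst (ℕ._≤ halve m (toℕ a)) (sym toℕ-c) le)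

  -- The sign (-1)^(1 + 2 + ... + m), which is the Jacobi symbol (2/N) for N = 2m + 1.
  triangleSign : ℕ → ℤ
  triangleSign zero    = + 1
  triangleSign (suc m) = sign (suc m) * triangleSign m

  det-Halving : ∀ m → det _ (Halving m) ≡ triangleSign m
  det-Halving zero    = refl
  det-Halving (suc m) = trans (det-Halving-suc m) (cong (sign (suc m) *_) (det-Halving m))

  sign-square : ∀ k → sign k * sign k ≡ + 1
  sign-square zero    = refl
  sign-square (suc k) = trans (neg-square (sign k)) (sign-square k)
    where
    neg-square : ∀ x → - x * - x ≡ x * x
    neg-square = solve-∀

  -- Among four consecutive factors two equal `sign m` and two equal its negative. Four steps in `m`
  -- are eight in `2m + 1`, whence the dependence on the residue modulo 8.
  triangleSign-+4 : ∀ m → triangleSign (4 ℕ.+ m) ≡ triangleSign m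
  triangleSign-+4 m = begin
    triangleSign (4 ℕ.+ m)                                  ≡⟨ regroup (sign m) (triangleSign m) ⟩
    (sign m * sign m) * (sign m * sign m) * triangleSign m  ≡⟨ cong (λ x → x * x * triangleSign m) (sign-square m) ⟩
    + 1 * triangleSign m                                    ≡⟨ *-identityˡ (triangleSign m) ⟩
    triangleSign m ∎
    where
    open ≡-Reasoning
    regroup : ∀ x y → - - - - x * (- - - x * (- - x * (- x * y))) ≡ (x * x) * (x * x) * y
    regroup = solve-∀

  triangleSign-±1 : ∀ m → suc (double m) ℕ.% 8 ≡ 1 ⊎ suc (double m) ℕ.% 8 ≡ 7 → triangleSign m ≡ + 1
  triangleSign-±1 0 _ = refl
  triangleSign-±1 1 (inj₁ ())
  triangleSign-±1 1 (inj₂ ())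
  triangleSign-±1 2 (inj₁ ())
  triangleSign-±1 2 (inj₂ ())
  triangleSign-±1 3 _ = refl
  triangleSign-±1 (suc (suc (suc (suc m)))) N%8 = trans (triangleSign-+4 m) (triangleSign-±1 m N%8)

  triangleSign-±3 : ∀ m → suc (double m) ℕ.% 8 ≡ 3 ⊎ suc (double m) ℕ.% 8 ≡ 5 → triangleSign m ≡ - (+ 1)
  triangleSign-±3 0 (inj₁ ())
  triangleSign-±3 0 (inj₂ ())
  triangleSign-±3 1 _ = refl
  triangleSign-±3 2 _ = refl
  triangleSign-±3 3 (inj₁ ())
  triangleSign-±3 3 (inj₂ ())
  triangleSign-±3 (suc (suc (suc (suc m)))) N%8 = trans (triangleSign-+4 m) (triangleSign-±3 m N%8)

-- Congruences and the multiplicative order of 3.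

module OrderOfThree where

  open import Data.Nat
  open import Data.Nat.Properties
  open import Data.Nat.DivMod
  open import Data.Nat.Divisibility
  open import Data.Nat.Primality using (Prime; prime⇒irreducible; prime?)
  open import Data.Nat.Coprimality using (Coprime; coprime-divisor)
  open import Data.Nat.Tactic.RingSolver using (solve-∀)
  open import Data.Nat.ListAction using (product)
  open import Data.Fin using (toℕ; fromℕ<)
  open import Data.Fin.Properties using (toℕ-fromℕ<; toℕ<n; pigeonhole)
  open import Data.List using ([]; _∷_)
  open import Data.List.Relation.Unary.All using (All; []; _∷_)
  open import Data.Product using (_×_; _,_; proj₁; proj₂; ∃)
  open import Data.Sum using (inj₁; inj₂)
  open import Relation.Nullary using (¬_; contradiction; yes; no)
  open import Relation.Nullary.Decidable using (dec-true; dec-false; toWitness)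
  open import Relation.Binary.PropositionalEquality

  infix 4 _≡_[mod_]

  -- Multiples of `n` on both sides express congruence of integers without subtraction.
  record _≡_[mod_] (x y n : ℕ) : Set where
    constructor witness
    field
      a b     : ℕ
      shifted : x + a * n ≡ y + b * n

  module _ {n : ℕ} where

    ≡⇒mod : ∀ {x y} → x ≡ y → x ≡ y [mod n ]
    ≡⇒mod refl = witness 0 0 refl

    mod-sym : ∀ {x y} → x ≡ y [mod n ] → y ≡ x [mod n ]
    mod-sym (witness a b eq) = witness b a (sym eq)

    mod-trans : ∀ {x y z} → x ≡ y [mod n ] → y ≡ z [mod n ] → x ≡ z [mod n ]
    mod-trans {x} {y} {z} (witness a b eq) (witness c d eq′) = witness (a + c) (b + d) (begin
      x + (a + c) * n     ≡⟨ shift x a c n ⟩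
      (x + a * n) + c * n ≡⟨ cong (_+ c * n) eq ⟩
      (y + b * n) + c * n ≡⟨ swap y b c n ⟩
      (y + c * n) + b * n ≡⟨ cong (_+ b * n) eq′ ⟩
      (z + d * n) + b * n ≡⟨ swap z d b n ⟩
      (z + b * n) + d * n ≡⟨ shift z b d n ⟨
      z + (b + d) * n ∎)
      where
      open ≡-Reasoning
      shift : ∀ x a c n → x + (a + c) * n ≡ (x + a * n) + c * n
      shift = solve-∀
      swap : ∀ y b c n → (y + b * n) + c * n ≡ (y + c * n) + b * n
      swap = solve-∀

    mod-+ˡ : ∀ k {x y} → x ≡ y [mod n ] → k + x ≡ k + y [mod n ]
    mod-+ˡ k {x} {y} (witness a b eq) = witness a b (begin
      (k + x) + a * n ≡⟨ +-assoc k x _ ⟩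
      k + (x + a * n) ≡⟨ cong (k +_) eq ⟩
      k + (y + b * n) ≡⟨ +-assoc k y _ ⟨
      (k + y) + b * n ∎)
      where open ≡-Reasoning

    mod-+ˡ-cancel : ∀ k {x y} → k + x ≡ k + y [mod n ] → x ≡ y [mod n ]
    mod-+ˡ-cancel k {x} {y} (witness a b eq) = witness a b
      (+-cancelˡ-≡ k _ _ (trans (sym (+-assoc k x _)) (trans eq (+-assoc k y _))))

    mod-*ˡ : ∀ k {x y} → x ≡ y [mod n ] → k * x ≡ k * y [mod n ]
    mod-*ˡ k {x} {y} (witness a b eq) = witness (k * a) (k * b) (begin
      k * x + (k * a) * n ≡⟨ distrib k x a n ⟨
      k * (x + a * n)     ≡⟨ cong (k *_) eq ⟩
      k * (y + b * n)     ≡⟨ distrib k y b n ⟩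
      k * y + (k * b) * n ∎)
      where
      open ≡-Reasoning
      distrib : ∀ k x a n → k * (x + a * n) ≡ k * x + (k * a) * n
      distrib = solve-∀

    mod-+n* : ∀ x k → x + k * n ≡ x [mod n ]
    mod-+n* x k = witness 0 k (+-identityʳ _)

    ∣⇒mod : ∀ {v u} → n ∣ u → v + u ≡ v [mod n ]
    ∣⇒mod {v} (divides q refl) = mod-+n* v q

    mod⇒∣ : ∀ {v u} → v + u ≡ v [mod n ] → n ∣ u
    mod⇒∣ {v} {u} (witness a b eq) = ∣m+n∣m⇒∣n {m = a * n}
      (divides b (trans (+-comm (a * n) u) (+-cancelˡ-≡ v _ _ (trans (sym (+-assoc v u _)) eq)))) (n∣m*n a)

    module _ .{{_ : NonZero n}} where

      mod⇒% : ∀ {x y} → x ≡ y [mod n ] → x % n ≡ y % n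
      mod⇒% {x} {y} (witness a b eq) = trans (sym ([m+kn]%n≡m%n x a n)) (trans (cong (_% n) eq) ([m+kn]%n≡m%n y b n))

      mod-% : ∀ x → x % n ≡ x [mod n ]
      mod-% x = witness (x / n) 0 (trans (sym (m≡m%n+[m/n]*n x n)) (sym (+-identityʳ x)))

      %⇒mod : ∀ {x y} → x % n ≡ y % n → x ≡ y [mod n ]
      %⇒mod {x} {y} eq = mod-trans (mod-sym (mod-% x)) (mod-trans (≡⇒mod eq) (mod-% y))

      mod-<⇒≡ : ∀ {x y} → x < n → y < n → x ≡ y [mod n ] → x ≡ y
      mod-<⇒≡ x<n y<n eq = trans (sym (m<n⇒m%n≡m x<n)) (trans (mod⇒% eq) (m<n⇒m%n≡m y<n))

  mod-scale : ∀ {d x y} w → x ≡ y [mod d ] → x * w ≡ y * w [mod d * w ]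
  mod-scale {d} {x} {y} w (witness a b eq) = witness a b (trans (distrib x a d w) (trans (cong (_* w) eq) (sym (distrib y b d w))))
    where
    distrib : ∀ x a d w → x * w + a * (d * w) ≡ (x + a * d) * w
    distrib = solve-∀

  mod-unscale : ∀ {d x y} w .{{_ : NonZero w}} → x * w ≡ y * w [mod d * w ] → x ≡ y [mod d ]
  mod-unscale {d} {x} {y} w (witness a b eq) = witness a b (*-cancelʳ-≡ _ _ w (trans (sym (distrib x a d w)) (trans eq (distrib y b d w))))
    where
    distrib : ∀ x a d w → x * w + a * (d * w) ≡ (x + a * d) * w
    distrib = solve-∀

  -- Says 3^t ≡ 1 modulo `d`, with `3 ^ t - 1` named so that powers can be expanded around 1.
  Unit : ℕ → ℕ → Set
  Unit d t = ∃ λ u → 3 ^ t ≡ suc u × d ∣ u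

  3^-suc : ∀ t → ∃ λ u → 3 ^ t ≡ suc u
  3^-suc t with 3 ^ t | m^n>0 3 t
  ... | suc u | _ = u , refl

  mod⇒Unit : ∀ {d} t → 3 ^ t ≡ 1 [mod d ] → Unit d t
  mod⇒Unit t eq with u , 3ᵗ ← 3^-suc t = u , 3ᵗ , mod⇒∣ {v = 1} (subst (_≡ 1 [mod _ ]) 3ᵗ eq)

  Unit⇒mod : ∀ {d} t → Unit d t → 3 ^ t ≡ 1 [mod d ]
  Unit⇒mod t (u , 3ᵗ , d∣u) = mod-trans (≡⇒mod 3ᵗ) (∣⇒mod d∣u)

  binomial₂ : ∀ u n → ∃ λ c → suc u ^ n ≡ suc (n * u + u * u * c)
  binomial₂ u zero    = 0 , cong suc (sym (*-zeroʳ (u * u)))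
  binomial₂ u (suc n) with c , eq ← binomial₂ u n =
    c + n + u * c , trans (cong (suc u *_) eq) (expand u n c)
    where
    expand : ∀ u n c → (1 + u) * (1 + (n * u + u * u * c)) ≡ 1 + ((1 + n) * u + u * u * (c + n + u * c))
    expand = solve-∀

  Unit-* : ∀ {d} t s → Unit d t → Unit d (t * s)
  Unit-* {d} t s (u , 3ᵗ , d∣u) with c , eq ← binomial₂ u s =
    s * u + u * u * c
    , trans (sym (^-*-assoc 3 t s)) (trans (cong (_^ s) 3ᵗ) eq)
    , ∣m∣n⇒∣m+n (∣n⇒∣m*n s d∣u) (∣m⇒∣m*n c (∣m⇒∣m*n u d∣u))

  -- In (1 + u)^p = 1 + p u + u² c, both `p u` and `u²` are multiples of `p d` when `p` and `d`
  -- divide `u`.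
  Unit-lift : ∀ {p d} t → Unit p t → Unit d t → Unit (p * d) (t * p)
  Unit-lift {p} {d} t (u , 3ᵗ , p∣u) (u′ , 3ᵗ′ , d∣u′) with refl ← suc-injective (trans (sym 3ᵗ) 3ᵗ′) | c , eq ← binomial₂ u p =
    p * u + u * u * c
    , trans (sym (^-*-assoc 3 t p)) (trans (cong (_^ p) 3ᵗ) eq)
    , ∣m∣n⇒∣m+n (*-monoʳ-∣ p d∣u′) (∣m⇒∣m*n c (*-pres-∣ p∣u d∣u′))

  -- From 3^(r+s) - 1 = 3^r (3^s - 1) + (3^r - 1).
  Unit-cancelʳ : ∀ {d} r s → Unit d (r + s) → Unit d s → Unit d r
  Unit-cancelʳ {d} r s (u , 3ʳ⁺ˢ , d∣u) (w , 3ˢ , d∣w) with v , 3ʳ ← 3^-suc r =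
    v , 3ʳ , ∣m+n∣m⇒∣n (subst (d ∣_) u≡ d∣u) (∣n⇒∣m*n (suc v) d∣w)
    where
    expand : ∀ v w → (1 + v) * (1 + w) ≡ 1 + ((1 + v) * w + v)
    expand = solve-∀
    u≡ : u ≡ suc v * w + v
    u≡ = suc-injective (begin
      suc u               ≡⟨ 3ʳ⁺ˢ ⟨
      3 ^ (r + s)         ≡⟨ ^-distribˡ-+-* 3 r s ⟩
      3 ^ r * 3 ^ s       ≡⟨ cong₂ _*_ 3ʳ 3ˢ ⟩
      suc v * suc w       ≡⟨ expand v w ⟩
      suc (suc v * w + v) ∎)
      where open ≡-Reasoning

  record IsOrder (d k : ℕ) : Set where
    field
      positive : 0 < k
      unit     : Unit d k
      minimal  : ∀ i → 0 < i → i < k → ¬ Unit d i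

  module _ {d : ℕ} (d⊥3 : Coprime d 3) where

    coprime-3^ : ∀ i {u} → d ∣ 3 ^ i * u → d ∣ u
    coprime-3^ zero    {u} d∣ = subst (d ∣_) (+-identityʳ u) d∣
    coprime-3^ (suc i) {u} d∣ = coprime-3^ i (coprime-divisor d⊥3 (subst (d ∣_) (*-assoc 3 (3 ^ i) u) d∣))

    -- Two of the `d + 1` powers 3^0, ..., 3^d agree modulo `d`, and the smaller one cancels. The
    -- bound `t ≤ d` matches the fuel of `ord3`.
    order-exists : .{{_ : NonZero d}} → ∃ λ t → 0 < t × t ≤ d × Unit d t
    order-exists with i , j , i<j , eq ← pigeonhole {d} {suc d} ≤-refl (λ i → fromℕ< (m%n<n (3 ^ toℕ i) d)) =
      t , m<n⇒0<n∸m i<j , ≤-trans (m∸n≤m (toℕ j) (toℕ i)) (≤-pred (toℕ<n j)) , proj₁ 3ᵗ , proj₂ 3ᵗ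
      , coprime-3^ (toℕ i) (mod⇒∣ {v = 3 ^ toℕ i} (mod-trans (≡⇒mod (sym 3ʲ)) (mod-sym (%⇒mod 3ⁱ≡3ʲ))))
      where
      open ≡-Reasoning
      t = toℕ j ∸ toℕ i
      3ᵗ = 3^-suc t
      3ⁱ≡3ʲ : 3 ^ toℕ i % d ≡ 3 ^ toℕ j % d
      3ⁱ≡3ʲ = trans (sym (toℕ-fromℕ< _)) (trans (cong toℕ eq) (toℕ-fromℕ< _))
      3ʲ : 3 ^ toℕ j ≡ 3 ^ toℕ i + 3 ^ toℕ i * proj₁ 3ᵗ
      3ʲ = begin
        3 ^ toℕ j                        ≡⟨ cong (3 ^_) (m+[n∸m]≡n (<⇒≤ i<j)) ⟨
        3 ^ (toℕ i + t)                  ≡⟨ ^-distribˡ-+-* 3 (toℕ i) t ⟩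
        3 ^ toℕ i * 3 ^ t                ≡⟨ cong (3 ^ toℕ i *_) (proj₂ 3ᵗ) ⟩
        3 ^ toℕ i * suc (proj₁ 3ᵗ)       ≡⟨ *-suc (3 ^ toℕ i) (proj₁ 3ᵗ) ⟩
        3 ^ toℕ i + 3 ^ toℕ i * proj₁ 3ᵗ ∎

  -- A solution `t` inside the search window keeps the fuel from running out, so the default value 0
  -- is never returned.
  ordSearch-correct : ∀ d fuel k t → k ≤ t → t < k + fuel → Unit (suc d) t →
    Unit (suc d) (ordSearch (suc d) fuel k) × k ≤ ordSearch (suc d) fuel k
    × (∀ i → k ≤ i → i < ordSearch (suc d) fuel k → ¬ Unit (suc d) i)
  ordSearch-correct d zero k t k≤t t< unit =
    contradiction (≤-trans t< (≤-reflexive (+-identityʳ k))) (≤⇒≯ k≤t)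
  ordSearch-correct d (suc fuel) k t k≤t t< unit with 3 ^ k % suc d ≟ 1 % suc d
  ... | yes eq rewrite dec-true (3 ^ k % suc d ≟ 1 % suc d) eq =
    mod⇒Unit k (%⇒mod eq) , ≤-refl , λ i k≤i i<k _ → <⇒≱ i<k k≤i
  ... | no neq rewrite dec-false (3 ^ k % suc d ≟ 1 % suc d) neq =
    proj₁ later , <⇒≤ (proj₁ (proj₂ later)) , min′
    where
    ¬unit-k : ¬ Unit (suc d) k
    ¬unit-k unit-k = neq (mod⇒% (Unit⇒mod k unit-k))
    k<t : k < t
    k<t = ≤∧≢⇒< k≤t λ { refl → ¬unit-k unit }
    later = ordSearch-correct d fuel (suc k) t k<t (≤-trans t< (≤-reflexive (+-suc k fuel))) unit
    min′ : ∀ i → k ≤ i → i < ordSearch (suc d) fuel (suc k) → ¬ Unit (suc d) i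
    min′ i k≤i i< with k ≟ i
    ... | yes refl = ¬unit-k
    ... | no k≢i   = proj₂ (proj₂ later) i (≤∧≢⇒< k≤i k≢i) i<

  ordSearch-isOrder : ∀ {d k} → Unit d k × 1 ≤ k × (∀ i → 1 ≤ i → i < k → ¬ Unit d i) → IsOrder d k
  ordSearch-isOrder (u , le , min) = record { positive = le ; unit = u ; minimal = min }

  ord3-isOrder : ∀ d → .{{_ : NonZero d}} → Coprime d 3 → IsOrder d (ord3 d)
  ord3-isOrder (suc d) d⊥3 = search (order-exists d⊥3)
    where
    search : (∃ λ t → 0 < t × t ≤ suc d × Unit (suc d) t) → IsOrder (suc d) (ord3 (suc d))
    search (t , 0<t , t≤d , unit) = ordSearch-isOrder (ordSearch-correct d (suc d) 1 t 0<t (s≤s t≤d) unit)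

  odd-* : ∀ a b → IsOdd a → IsOdd b → IsOdd (a * b)
  odd-* a b odd-a odd-b = trans (%-distribˡ-* a b 2) (cong₂ (λ x y → (x * y) % 2) odd-a odd-b)

  odd-*⁻ʳ : ∀ a b → IsOdd (a * b) → IsOdd b
  odd-*⁻ʳ a b odd with b % 2 in eq | m%n<n b 2
  ... | 1 | _ = refl
  ... | 0 | _ with () ← trans (sym odd) (trans (%-distribˡ-* a b 2) (trans (cong (λ y → ((a % 2) * y) % 2) eq) (cong (_% 2) (*-zeroʳ (a % 2)))))
  ... | suc (suc _) | s≤s (s≤s ())

  -- The order divides `t`: the remainder of `t` is again an exponent giving 1, and minimality
  -- forces it to be 0. A divisor of an odd number is odd.
  order-odd : ∀ {d k} t → IsOrder d k → IsOdd t → Unit d t → IsOdd k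
  order-odd {d} {suc k} t isOrder odd-t unit-t = odd-*⁻ʳ (t / suc k) (suc k) (subst IsOdd t≡ odd-t)
    where
    open IsOrder isOrder
    r = t % suc k
    unit-r : Unit d r
    unit-r = Unit-cancelʳ r (t / suc k * suc k) (subst (Unit d) (m≡m%n+[m/n]*n t (suc k)) unit-t)
      (subst (Unit d) (*-comm (suc k) (t / suc k)) (Unit-* (suc k) (t / suc k) unit))
    r≡0 : ∀ r → r < suc k → Unit d r → r ≡ 0
    r≡0 zero    _   _    = refl
    r≡0 (suc r) r<k unit = contradiction unit (minimal (suc r) (s≤s z≤n) r<k)
    t≡ : t ≡ t / suc k * suc k
    t≡ = trans (m≡m%n+[m/n]*n t (suc k)) (cong (_+ t / suc k * suc k) (r≡0 r (m%n<n t (suc k)) unit-r))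
  order-odd {k = zero} _ isOrder _ _ with () ← IsOrder.positive isOrder

  -- The list may repeat entries, which covers prime powers. Each entry multiplies the exponent by
  -- its own odd `k` and by the odd `p`.
  odd-exponent : ∀ ps → All (λ p → IsOdd p × ∃ λ k → IsOdd k × Unit p k) ps →
    ∃ λ t → IsOdd t × Unit (product ps) t
  odd-exponent []       []                             = 1 , refl , 2 , refl , 1∣ 2
  odd-exponent (p ∷ ps) ((odd-p , k , odd-k , unit-k) ∷ all) with t , odd-t , unit-t ← odd-exponent ps all =
    k * t * p , odd-* (k * t) p (odd-* k t odd-k odd-t) odd-p
    , Unit-lift (k * t) (Unit-* k t unit-k) (subst (Unit (product ps)) (*-comm t k) (Unit-* t k unit-t))

  prime-3 : Prime 3
  prime-3 = toWitness {a? = prime? 3} _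

  ∤3⇒coprime : ∀ {d} → ¬ (3 ∣ d) → Coprime d 3
  ∤3⇒coprime 3∤d (i∣d , i∣3) with prime⇒irreducible prime-3 i∣3
  ... | inj₁ i≡1  = i≡1
  ... | inj₂ refl = contradiction i∣d 3∤d

open Determinant
open CycleElimination
open HalvingPermutation
open OrderOfThree
open import Data.Nat
open import Data.Nat.Properties
open import Data.Nat.DivMod hiding (_div_)
open import Data.Nat.Divisibility
open import Data.Nat.GCD using (gcd; gcd[m,n]∣m; gcd[m,n]∣n; gcd[m,n]≢0)
open import Data.Nat.Primality using (Prime)
open import Data.Nat.Primality.Factorisation using (PrimeFactorisation; factorise)
open import Data.Nat.Coprimality using (Coprime; coprime-divisor; coprime⇒gcd≡1; gcd≡1⇒coprime; coprime-/gcd)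
import Data.Nat.Coprimality as Coprimality
open import Data.Nat.Tactic.RingSolver using (solve-∀)
open import Data.Nat.ListAction using (sum; product)
open import Data.Nat.ListAction.Properties using (∈⇒∣product)
open import Data.Nat.GeneralisedArithmetic using (fold)
open import Data.Integer as ℤ using (ℤ; +_; -_)
import Data.Integer.Properties as ℤ
open import Data.Bool using (true; false)
open import Data.Bool.Properties using (¬-not)
open import Data.Fin using (Fin; toℕ; fromℕ<)
open import Data.Fin.Properties using (toℕ-fromℕ<; toℕ<n; toℕ-injective)
open import Data.List using (List; []; _∷_; map; filter; upTo; length)
open import Data.List.Properties using (length-map)
open import Data.List.Membership.Propositional using (_∈_)
open import Data.List.Membership.Propositional.Properties using (∈-filter⁺; ∈-filter⁻; ∈-map⁺; ∈-map⁻; ∈-upTo⁺)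
open import Data.List.Relation.Unary.Any using (here; there)
open import Data.List.Relation.Unary.All as All using (All)
open import Data.List.Relation.Unary.AllPairs using (_∷_)
import Data.List.Relation.Unary.AllPairs.Properties as AllPairs
open import Data.List.Relation.Unary.Unique.Propositional using (Unique)
import Data.List.Relation.Unary.Unique.Propositional.Properties as Unique
open import Data.Product using (Σ; _×_; _,_; proj₁; proj₂; ∃; ∃₂)
open import Data.Sum using (_⊎_; inj₁; inj₂; [_,_]′)
open import Function using (_∘_; id)
open import Relation.Nullary using (¬_; contradiction)
open import Relation.Binary.PropositionalEquality

-- Arithmetic of `T`, of halving and of powers of 2.

T-even : ∀ a → T (a * 2) ≡ a
T-even a rewrite m*n%n≡0 a 2 {{_}} = m*n/n≡m a 2

T-odd : ∀ a → T (1 + a * 2) ≡ 3 * a + 2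
T-odd a rewrite [m+kn]%n≡m%n 1 a 2 {{_}} = trans (cong (_/ 2) (regroup a)) (m*n/n≡m (3 * a + 2) 2)
  where
  regroup : ∀ a → 3 * (1 + a * 2) + 1 ≡ (3 * a + 2) * 2
  regroup = solve-∀

even⊎odd : ∀ i → ∃ λ a → i ≡ a * 2 ⊎ i ≡ 1 + a * 2
even⊎odd zero = 0 , inj₁ refl
even⊎odd (suc i) with even⊎odd i
... | a , inj₁ refl = a , inj₂ refl
... | a , inj₂ refl = suc a , inj₁ refl

halve-bound : ∀ m i → i ≤ double m → halve m i ≤ double m
halve-bound m i i≤2m with halveView m i
... | inj₁ (_ , dbl)     = ≤-trans (double-cancel-≤ (subst (_≤ double m) (sym dbl) i≤2m)) (m≤double m)
... | inj₂ (_ , _ , dbl) = ≮⇒≥ λ h>2m → <⇒≱ (double-mono h>2m) (begin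
  double (halve m i)             ≡⟨ dbl ⟩
  i + suc (double m)             ≤⟨ +-monoˡ-≤ (suc (double m)) i≤2m ⟩
  double m + suc (double m)      ≡⟨ +-suc (double m) (double m) ⟩
  suc (double m + double m)      ≡⟨ cong suc (double≡+ (double m)) ⟨
  suc (double (double m)) ∎)
  where
  open ≤-Reasoning
  double-mono : ∀ {a b} → a < b → suc (suc (double a)) ≤ double b
  double-mono {zero}  {suc b} (s≤s _)         = s≤s (s≤s z≤n)
  double-mono {suc a} {suc b} (s≤s a<b) = s≤s (s≤s (double-mono a<b))

doublings-+ : ∀ {x y z : ℤ} {a b e : ℕ} → a ≡ e → x ≡ + (2 ^ b) ℤ.* y → y ≡ + (2 ^ e) ℤ.* z →
  x ≡ + (2 ^ (a + b)) ℤ.* z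
doublings-+ {z = z} {b = b} {e = e} refl refl refl = begin
  + (2 ^ b) ℤ.* (+ (2 ^ e) ℤ.* z) ≡⟨ ℤ.*-assoc (+ (2 ^ b)) (+ (2 ^ e)) z ⟨
  (+ (2 ^ b) ℤ.* + (2 ^ e)) ℤ.* z ≡⟨ cong (ℤ._* z) (ℤ.pos-* (2 ^ b) (2 ^ e)) ⟨
  + (2 ^ b * 2 ^ e) ℤ.* z         ≡⟨ cong (λ n → + n ℤ.* z) (trans (*-comm (2 ^ b) (2 ^ e)) (sym (^-distribˡ-+-* 2 e b))) ⟩
  + (2 ^ (e + b)) ℤ.* z ∎
  where open ≡-Reasoning

-- The modular Collatz graph for `N = 2m + 1`.

module Collatz (m : ℕ) where

  N : ℕ
  N = suc (double m)

  ⟦_⟧ : ℕ → Fin N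
  ⟦ x ⟧ = fromℕ< (m%n<n x N)

  toℕ-⟦⟧ : ∀ x → toℕ ⟦ x ⟧ ≡ x % N
  toℕ-⟦⟧ x = toℕ-fromℕ< (m%n<n x N)

  toℕ-⟦⟧-mod : ∀ x → toℕ ⟦ x ⟧ ≡ x [mod N ]
  toℕ-⟦⟧-mod x = mod-trans (≡⇒mod (toℕ-⟦⟧ x)) (mod-% x)

  ⟦⟧-cong : ∀ {x y} → x ≡ y [mod N ] → ⟦ x ⟧ ≡ ⟦ y ⟧
  ⟦⟧-cong {x} {y} eq = toℕ-injective (trans (toℕ-⟦⟧ x) (trans (mod⇒% eq) (sym (toℕ-⟦⟧ y))))

  ⟦⟧-injective : ∀ {x y} → ⟦ x ⟧ ≡ ⟦ y ⟧ → x ≡ y [mod N ]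
  ⟦⟧-injective {x} {y} eq = %⇒mod (trans (sym (toℕ-⟦⟧ x)) (trans (cong toℕ eq) (toℕ-⟦⟧ y)))

  ⟦toℕ⟧ : ∀ x → ⟦ toℕ x ⟧ ≡ x
  ⟦toℕ⟧ x = toℕ-injective (trans (toℕ-⟦⟧ (toℕ x)) (m<n⇒m%n≡m (toℕ<n x)))

  N≡ : N ≡ 1 + (m + m)
  N≡ = cong suc (double≡+ m)

  -- The inverse of 2 modulo `N` is `m + 1`.
  mod-2*-cancel : ∀ a b → 2 * a ≡ 2 * b [mod N ] → a ≡ b [mod N ]
  mod-2*-cancel a b eq = mod-trans (mod-sym (reduce a)) (mod-trans (mod-*ˡ (suc m) eq) (reduce b))
    where
    expand : ∀ m a → (1 + m) * (2 * a) ≡ a + a * (1 + (m + m))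
    expand = solve-∀
    reduce : ∀ a → suc m * (2 * a) ≡ a [mod N ]
    reduce a = mod-trans (≡⇒mod (trans (expand m a) (cong (λ n → a + a * n) (sym N≡)))) (mod-+n* a a)

  2*halve : ∀ i → 2 * halve m i ≡ i [mod N ]
  2*halve i with halveView m i
  ... | inj₁ (_ , dbl)     = ≡⇒mod (trans (2*≡double (halve m i)) dbl)
    where
    2*≡double : ∀ a → 2 * a ≡ double a
    2*≡double a = trans (cong (λ b → a + b) (+-identityʳ a)) (sym (double≡+ a))
  ... | inj₂ (_ , _ , dbl) = witness 0 1 (trans (+-identityʳ _)
    (trans (cong (λ b → halve m i + b) (+-identityʳ (halve m i))) (trans (sym (double≡+ (halve m i)))
      (trans dbl (cong (λ n → i + n) (sym (+-identityʳ N)))))))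

  -- Halving, doubling, and x ↦ 3x + 1/2, where `suc m` is 1/2 modulo `N`.
  p π f : Fin N → Fin N
  p i = ⟦ halve m (toℕ i) ⟧
  π x = ⟦ 2 * toℕ x ⟧
  f x = ⟦ 3 * toℕ x + suc m ⟧

  p-⟦⟧ : ∀ i h → 2 * h ≡ toℕ i [mod N ] → p i ≡ ⟦ h ⟧
  p-⟦⟧ i h eq = ⟦⟧-cong (mod-2*-cancel (halve m (toℕ i)) h (mod-trans (2*halve (toℕ i)) (mod-sym eq)))

  f-⟦⟧ : ∀ x → f ⟦ x ⟧ ≡ ⟦ 3 * x + suc m ⟧
  f-⟦⟧ x = ⟦⟧-cong (mod-trans (≡⇒mod (+-comm (3 * toℕ ⟦ x ⟧) (suc m)))
    (mod-trans (mod-+ˡ (suc m) (mod-*ˡ 3 (toℕ-⟦⟧-mod x))) (≡⇒mod (+-comm (suc m) (3 * x)))))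

  p∘π : ∀ x → p (π x) ≡ x
  p∘π x = trans (p-⟦⟧ (π x) (toℕ x) (mod-sym (toℕ-⟦⟧-mod (2 * toℕ x)))) (⟦toℕ⟧ x)

  π∘p : ∀ i → π (p i) ≡ i
  π∘p i = trans (⟦⟧-cong (mod-trans (mod-*ˡ 2 (toℕ-⟦⟧-mod (halve m (toℕ i)))) (2*halve (toℕ i)))) (⟦toℕ⟧ i)

  open Elimination p π f p∘π π∘p

  ∅ : Region N
  ∅ _ = false

  δ-⟦⟧ : ∀ x j → 𝟙 ((x % N) ≡ᵇ toℕ j) ≡ δ ⟦ x ⟧ j
  δ-⟦⟧ x j = cong (λ v → 𝟙 (v ≡ᵇ toℕ j)) (sym (toℕ-⟦⟧ x))

  -- Since `N` is odd, exactly one of `i` and `i + N` is even. The even one contributes x = i/2, the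
  -- odd one (3i + 1)/2 = 3x + 1/2.
  C-row : ∀ i j → C N i j ≡ row ∅ (p i) j
  C-row i j = trans (cong₂ ℤ._+_ (δ-⟦⟧ (T (toℕ i)) j) (δ-⟦⟧ (T (toℕ i + N)) j)) (rows (even⊎odd (toℕ i)))
    where
    rows : (∃ λ a → toℕ i ≡ a * 2 ⊎ toℕ i ≡ 1 + a * 2) →
      δ ⟦ T (toℕ i) ⟧ j ℤ.+ δ ⟦ T (toℕ i + N) ⟧ j ≡ δ (p i) j ℤ.+ δ (f (p i)) j
    rows (a , inj₁ i≡2a) = cong₂ (λ x y → δ x j ℤ.+ δ y j)
      (trans (cong ⟦_⟧ (trans (cong T i≡2a) (T-even a))) (sym p≡))
      (trans (trans (cong ⟦_⟧ (trans (cong T i+N≡) (T-odd (a + m)))) (⟦⟧-cong q≡)) (sym (trans (cong f p≡) (f-⟦⟧ a))))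
      where
      p≡ : p i ≡ ⟦ a ⟧
      p≡ = p-⟦⟧ i a (≡⇒mod (trans (*-comm 2 a) (sym i≡2a)))
      regroup₁ : ∀ a m → a * 2 + (1 + (m + m)) ≡ 1 + (a + m) * 2
      regroup₁ = solve-∀
      i+N≡ : toℕ i + N ≡ 1 + (a + m) * 2
      i+N≡ = trans (cong₂ _+_ i≡2a N≡) (regroup₁ a m)
      regroup₂ : ∀ a m → 3 * (a + m) + 2 ≡ 3 * a + (1 + m) + 1 * (1 + (m + m))
      regroup₂ = solve-∀
      q≡ : 3 * (a + m) + 2 ≡ 3 * a + suc m [mod N ]
      q≡ = mod-trans (≡⇒mod (trans (regroup₂ a m) (cong (λ n → 3 * a + suc m + 1 * n) (sym N≡)))) (mod-+n* _ 1)
    -- For odd `i` the even representative is `i + N`, so the two summands change places.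
    rows (a , inj₂ i≡1+2a) = trans (ℤ.+-comm (δ ⟦ T (toℕ i) ⟧ j) (δ ⟦ T (toℕ i + N) ⟧ j)) (cong₂ (λ x y → δ x j ℤ.+ δ y j)
      (trans (cong ⟦_⟧ (trans (cong T i+N≡) (T-even (a + suc m)))) (sym p≡))
      (trans (trans (cong ⟦_⟧ (trans (cong T i≡1+2a) (T-odd a))) (⟦⟧-cong (mod-sym q≡))) (sym (trans (cong f p≡) (f-⟦⟧ (a + suc m))))))
      where
      regroup₁ : ∀ a m → 1 + a * 2 + (1 + (m + m)) ≡ (a + (1 + m)) * 2
      regroup₁ = solve-∀
      i+N≡ : toℕ i + N ≡ (a + suc m) * 2
      i+N≡ = trans (cong₂ _+_ i≡1+2a N≡) (regroup₁ a m)
      p≡ : p i ≡ ⟦ a + suc m ⟧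
      p≡ = p-⟦⟧ i (a + suc m) (mod-trans (≡⇒mod (trans (*-comm 2 (a + suc m)) (trans (sym i+N≡) (cong (λ n → toℕ i + n) (sym (+-identityʳ N)))))) (mod-+n* (toℕ i) 1))
      regroup₂ : ∀ a m → 3 * (a + (1 + m)) + (1 + m) ≡ 3 * a + 2 + 2 * (1 + (m + m))
      regroup₂ = solve-∀
      q≡ : 3 * (a + suc m) + suc m ≡ 3 * a + 2 [mod N ]
      q≡ = mod-trans (≡⇒mod (trans (regroup₂ a m) (cong (λ n → 3 * a + 2 + 2 * n) (sym N≡)))) (mod-+n* _ 2)

  det-C : det N (C N) ≡ D ∅
  det-C = det-cong C-row

  det-p : det N (λ i → δ (p i)) ≡ triangleSign m
  det-p = trans (det-cong (λ i j → cong (λ v → 𝟙 (v ≡ᵇ toℕ j)) (trans (toℕ-⟦⟧ (halve m (toℕ i)))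
    (m<n⇒m%n≡m (s≤s (halve-bound m (toℕ i) (≤-pred (toℕ<n i)))))))) (det-Halving m)

  -- m (m + 1) is the fixed point of f, so elt conjugates multiplication by 3 to f.
  origin : ℕ
  origin = m * suc m

  elt : ℕ → Fin N
  elt y = ⟦ origin + y ⟧

  elt-cong : ∀ {x y} → x ≡ y [mod N ] → elt x ≡ elt y
  elt-cong = ⟦⟧-cong ∘ mod-+ˡ origin

  elt-injective : ∀ {x y} → elt x ≡ elt y → x ≡ y [mod N ]
  elt-injective = mod-+ˡ-cancel origin ∘ ⟦⟧-injective

  elt-surjective : ∀ x → ∃ λ y → elt y ≡ x
  -- As `double m` is -1 modulo `N`, the witness is `x` minus the origin.
  elt-surjective x = toℕ x + origin * double m , trans
    (⟦⟧-cong (mod-trans (≡⇒mod (regroup origin (toℕ x) (double m))) (mod-+n* (toℕ x) origin))) (⟦toℕ⟧ x)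
    where
    regroup : ∀ o x n → o + (x + o * n) ≡ x + o * (1 + n)
    regroup = solve-∀

  f-elt : ∀ y → f (elt y) ≡ elt (3 * y)
  f-elt y = trans (f-⟦⟧ (origin + y)) (⟦⟧-cong
    (mod-trans (≡⇒mod (trans (regroup m y) (cong (λ n → origin + 3 * y + suc m * n) (sym N≡)))) (mod-+n* _ (suc m))))
    where
    regroup : ∀ m y → 3 * (m * (1 + m) + y) + (1 + m) ≡ m * (1 + m) + 3 * y + (1 + m) * (1 + (m + m))
    regroup = solve-∀

  fold-elt : ∀ k y → fold (elt y) f k ≡ elt (3 ^ k * y)
  fold-elt zero    y = cong elt (sym (+-identityʳ y))
  fold-elt (suc k) y = trans (cong f (fold-elt k y)) (trans (f-elt (3 ^ k * y)) (cong elt (sym (*-assoc 3 (3 ^ k) y))))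

  -- The elements of additive order d, counted from the fixed point.
  Class : ℕ → Fin N → Set
  Class d x = ∃₂ λ v w → N ≡ d * w × Coprime v d × x ≡ elt (v * w)

  -- Membership in the second class makes `d′` annihilate `v * w`. Then `d * w` divides
  -- `d′ * v * w`, and `v` is coprime to `d`.
  order-∣ : ∀ {d d′ x} → Class d x → Class d′ x → d ∣ d′
  order-∣ {d} {d′} (v , w , N≡dw , v⊥d , refl) (v′ , w′ , N≡d′w′ , _ , eq) =
    coprime-divisor (Coprimality.sym v⊥d) (*-cancelʳ-∣ w {{w≢0}} (subst₂ _∣_ N≡dw (regroup d′ v w) N∣))
    where
    w≢0 : NonZero w
    w≢0 = m*n≢0⇒n≢0 d {{subst NonZero N≡dw _}}
    regroup : ∀ d v w → d * (v * w) ≡ v * d * w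
    regroup = solve-∀
    regroup′ : ∀ d v w → d * (v * w) ≡ 0 + v * (d * w)
    regroup′ = solve-∀
    N∣ : N ∣ d′ * (v * w)
    N∣ = mod⇒∣ {v = 0} (mod-trans (mod-*ˡ d′ (elt-injective eq))
      (mod-trans (≡⇒mod (trans (regroup′ d′ v′ w′) (cong (λ n → v′ * n) (sym N≡d′w′)))) (mod-+n* 0 v′)))

  class-unique : ∀ {d d′ x} → Class d x → Class d′ x → d ≡ d′
  class-unique c c′ = ∣-antisym (order-∣ c c′) (order-∣ c′ c)

  module DivisorClass (d w : ℕ) (N≡dw : N ≡ d * w) where

    private
      instance
        d≢0 : NonZero d
        d≢0 = m*n≢0⇒m≢0 d {{subst NonZero N≡dw _}}
        w≢0 : NonZero w
        w≢0 = m*n≢0⇒n≢0 d {{subst NonZero N≡dw _}}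

    elt-scale : ∀ {v v′} → v ≡ v′ [mod d ] → elt (v * w) ≡ elt (v′ * w)
    elt-scale {v} {v′} eq = elt-cong (subst (v * w ≡ v′ * w [mod_]) (sym N≡dw) (mod-scale w eq))

    elt-unscale : ∀ {v v′} → elt (v * w) ≡ elt (v′ * w) → v ≡ v′ [mod d ]
    elt-unscale {v} {v′} eq = mod-unscale w (subst (v * w ≡ v′ * w [mod_]) N≡dw (elt-injective eq))

    -- The `i`-th iterate returns exactly when `d` divides `v * (3 ^ i - 1)`, hence, `v` being
    -- coprime to `d`, when 3^i ≡ 1 modulo `d`.
    class-period : ∀ {k v} → IsOrder d k → Coprime v d → Period f k (elt (v * w))
    class-period {k} {v} isOrder v⊥d = record { closes = closes ; minimal = minimal′ }
      where
      open IsOrder isOrder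
      fold≡ : ∀ i {u} → 3 ^ i ≡ suc u → fold (elt (v * w)) f i ≡ elt ((v + v * u) * w)
      fold≡ i {u} 3ⁱ = trans (fold-elt i (v * w)) (cong elt (trans (cong (_* (v * w)) 3ⁱ) (regroup u v w)))
        where
        regroup : ∀ u v w → (1 + u) * (v * w) ≡ (v + v * u) * w
        regroup = solve-∀
      closes : fold (elt (v * w)) f k ≡ elt (v * w)
      closes with u , 3ᵏ , d∣u ← unit = trans (fold≡ k 3ᵏ) (elt-scale {v + v * u} {v} (∣⇒mod (∣n⇒∣m*n v d∣u)))
      minimal′ : ∀ i → 0 < i → i < k → fold (elt (v * w)) f i ≢ elt (v * w)
      minimal′ i 0<i i<k eq with u , 3ⁱ ← 3^-suc i = minimal i 0<i i<k
        (u , 3ⁱ , coprime-divisor (Coprimality.sym v⊥d) (mod⇒∣ {v = v} (elt-unscale {v + v * u} {v} (trans (sym (fold≡ i 3ⁱ)) eq))))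

    -- Uses the filter of `φ`, with representatives 1 to `d`, so that the length is `φ d`. For
    -- `d = 1` it holds just the fixed point.
    classList : List (Fin N)
    classList = map (λ i → elt (suc i * w)) (filter (λ i → gcd (suc i) d ≟ 1) (upTo d))

    length-classList : length classList ≡ φ d
    length-classList = length-map (λ i → elt (suc i * w)) (filter (λ i → gcd (suc i) d ≟ 1) (upTo d))

    classList-sound : ∀ {x} → x ∈ classList → ∃ λ v → Coprime v d × x ≡ elt (v * w)
    classList-sound x∈ with i , i∈ , x≡ ← ∈-map⁻ _ x∈ =
      suc i , gcd≡1⇒coprime (proj₂ (∈-filter⁻ (λ i → gcd (suc i) d ≟ 1) {xs = upTo d} i∈)) , x≡

    classList-complete : ∀ {v} → Coprime v d → elt (v * w) ∈ classList
    classList-complete {v} v⊥d = subst (_∈ classList) (elt-scale i+1≡v)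
      (∈-map⁺ (λ i → elt (suc i * w)) (∈-filter⁺ (λ i → gcd (suc i) d ≟ 1) (∈-upTo⁺ (m%n<n (v + pred d) d))
        (coprime⇒gcd≡1 i+1⊥d)))
      where
      -- The index is `v - 1` modulo `d`, because the list uses `suc i`.
      i = (v + pred d) % d
      i+1≡v : suc i ≡ v [mod d ]
      i+1≡v = mod-trans (mod-+ˡ 1 (mod-% (v + pred d))) (mod-trans
        (≡⇒mod (trans (sym (+-suc v (pred d))) (cong (λ n → v + n) (trans (suc-pred d) (sym (+-identityʳ d)))))) (mod-+n* v 1))
      i+1⊥d : Coprime (suc i) d
      i+1⊥d {c} (c∣i+1 , c∣d) with witness a b eq ← i+1≡v = v⊥d
        (∣m+n∣m⇒∣n (subst (c ∣_) (trans eq (+-comm v (b * d))) (∣m∣n⇒∣m+n c∣i+1 (∣n⇒∣m*n a c∣d))) (∣n⇒∣m*n b c∣d) , c∣d)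

    classList-unique : Unique classList
    classList-unique = AllPairs.map⁺ (AllPairs.filter⁺ (λ i → gcd (suc i) d ≟ 1)
      (AllPairs.applyUpTo⁺₁ id d (λ i<j j<d eq →
        <⇒≢ i<j (mod-<⇒≡ (<-trans i<j j<d) j<d (mod-+ˡ-cancel 1 (elt-unscale eq))))))

    classList-closed : Coprime d 3 → ∀ {x} → x ∈ classList → f x ∈ classList
    classList-closed d⊥3 x∈ with v , v⊥d , refl ← classList-sound x∈ =
      subst (_∈ classList) (trans (cong elt (*-assoc 3 v w)) (sym (f-elt (v * w)))) (classList-complete 3v⊥d)
      where
      3v⊥d : Coprime (3 * v) d
      3v⊥d {c} (c∣3v , c∣d) = v⊥d
        (coprime-divisor {c} {3} (λ { (i∣c , i∣3) → d⊥3 (∣-trans i∣c c∣d , i∣3) }) c∣3v , c∣d)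

  -- Elimination of the classes, one divisor at a time.

  record Stage (c : ℕ → ℕ) (ds : List ℕ) : Set where
    field
      S      : Region N
      value  : D ∅ ≡ + (2 ^ sum (map c ds)) ℤ.* D S
      closed : Closed S
      within : ∀ {x} → S x ≡ true → ∃ λ d → d ∈ ds × Class d x
      covers : ∀ {d x} → d ∈ ds → Class d x → S x ≡ true

  -- The doubling exponent of a class is its number of orbits, φ(d) / k.
  stage-step : ∀ {c d k ds} → d ∣ N → Coprime d 3 → IsOrder d k → IsOdd k → c d ≡ φ d div k → All (d ≢_) ds →
    Stage c ds → Stage c (d ∷ ds)
  stage-step {k = zero} _ _ isOrder _ _ _ _ with () ← IsOrder.positive isOrder
  stage-step {c} {d} {suc k} {ds} (divides w N≡wd) d⊥3 isOrder odd c≡ d∉ds stage = record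
    { S = S′ ; value = doublings-+ e≡ value Pass.value ; closed = Pass.closed ; within = within′ ; covers = covers′ }
    where
    open Stage stage
    N≡dw : N ≡ d * w
    N≡dw = trans N≡wd (*-comm w d)
    open DivisorClass d w N≡dw
    A : List (Fin N)
    A = classList
    ∈A⇒Class : ∀ {x} → x ∈ A → Class d x
    ∈A⇒Class x∈A with v , v⊥d , x≡ ← classList-sound x∈A = v , w , N≡dw , v⊥d , x≡
    periodic : ∀ {x} → x ∈ A → Period f (suc k) x
    periodic x∈A with v , v⊥d , x≡ ← classList-sound x∈A =
      subst (Period f (suc k)) (sym x≡) (class-period isOrder v⊥d)
    module Pass = Doubling (eliminate {A} classList-unique (classList-closed d⊥3) periodic odd A id closed)
    open Pass using (S′; e)
    disjoint : ∀ {x} → x ∈ A → S x ≡ false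
    disjoint x∈A = ¬-not λ Sx → absurd (within Sx)
      where
      absurd : ¬ ∃ λ d′ → d′ ∈ ds × Class d′ _
      absurd (d′ , d′∈ds , c) = All.lookup d∉ds d′∈ds (class-unique (∈A⇒Class x∈A) c)
    -- The class lies outside the region before the pass and inside it afterwards, so the count
    -- falls from `φ d` to 0.
    φ≡ : φ d ≡ e * suc k
    φ≡ = begin
      φ d                    ≡⟨ length-classList ⟨
      length A               ≡⟨ count-empty disjoint ⟨
      count A S              ≡⟨ Pass.size ⟩
      e * suc k + count A S′ ≡⟨ cong (λ n → e * suc k + n) (count-full {S = S′} Pass.covers) ⟩
      e * suc k + 0          ≡⟨ +-identityʳ _ ⟩
      e * suc k ∎
      where open ≡-Reasoning
    e≡ : c d ≡ e
    e≡ = trans c≡ (trans (cong (_/ suc k) φ≡) (m*n/n≡m e (suc k)))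
    within′ : ∀ {x} → S′ x ≡ true → ∃ λ d′ → d′ ∈ d ∷ ds × Class d′ x
    within′ S′x = [ (λ Sx → let d′ , d′∈ds , class = within Sx in d′ , there d′∈ds , class)
                  , (λ x∈A → d , here refl , ∈A⇒Class x∈A) ]′ (Pass.within S′x)
    covers′ : ∀ {d′ x} → d′ ∈ d ∷ ds → Class d′ x → S′ x ≡ true
    covers′ (there d′∈ds) c = Pass.grows (covers d′∈ds c)
    covers′ (here refl) (v , w′ , N≡dw′ , v⊥d , refl) = Pass.covers
      (subst (λ u → elt (v * u) ∈ A) (*-cancelˡ-≡ w w′ d {{d≢0}} (trans (sym N≡dw) N≡dw′)) (classList-complete v⊥d))
      where
      d≢0 : NonZero d
      d≢0 = m*n≢0⇒m≢0 d {{subst NonZero N≡dw _}}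

  stage-all : ∀ ds → Unique ds → (∀ {d} → d ∈ ds → d ∣ N × Coprime d 3 × IsOrder d (ord3 d) × IsOdd (ord3 d)) →
    Stage (λ d → φ d div ord3 d) ds
  stage-all [] _ _ = record
    { S = ∅ ; value = sym (ℤ.*-identityˡ (D ∅)) ; closed = λ _ () ; within = λ () ; covers = λ () }
  stage-all (d ∷ ds) (d∉ds ∷ uniq) good = step (good (here refl))
    where
    step : d ∣ N × Coprime d 3 × IsOrder d (ord3 d) × IsOdd (ord3 d) → Stage (λ d → φ d div ord3 d) (d ∷ ds)
    step (d∣N , d⊥3 , isOrder , odd) =
      stage-step {λ d → φ d div ord3 d} d∣N d⊥3 isOrder odd refl d∉ds (stage-all ds uniq (good ∘ there))

  -- The determinant for `N = 3 ^ h * N₀`.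

  module _ {h N₀ : ℕ} (N≡3ʰN₀ : N ≡ 3 ^ h * N₀) (3∤N₀ : ¬ (3 ∣ N₀)) where

    N₀∣N : N₀ ∣ N
    N₀∣N = divides (3 ^ h) N≡3ʰN₀

    N₀≢0 : NonZero N₀
    N₀≢0 = m*n≢0⇒n≢0 (3 ^ h) {{subst NonZero N≡3ʰN₀ _}}

    ∣N₀⇒nonZero : ∀ {d} → d ∣ N₀ → NonZero d
    ∣N₀⇒nonZero {zero}  0∣N₀ = subst NonZero (0∣⇒≡0 0∣N₀) N₀≢0
    ∣N₀⇒nonZero {suc _} _    = _

    ∣N₀⇒coprime3 : ∀ {d} → d ∣ N₀ → Coprime d 3
    ∣N₀⇒coprime3 d∣N₀ = ∤3⇒coprime (λ 3∣d → 3∤N₀ (∣-trans 3∣d d∣N₀))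

    ∣N₀⇒isOrder : ∀ {d} → d ∣ N₀ → IsOrder d (ord3 d)
    ∣N₀⇒isOrder {d} d∣N₀ = ord3-isOrder d {{∣N₀⇒nonZero d∣N₀}} (∣N₀⇒coprime3 d∣N₀)

    -- With `w = N / q`, the cycle through `elt (1 * w)` has length `ord3 q`. No row has been
    -- reduced yet, so `even-cycle` applies to the empty region.
    det-even : (Σ ℕ λ p → Prime p × p ∣ N₀ × IsEven (ord3 p)) → det N (C N) ≡ + 0
    det-even (q , _ , q∣N₀ , even) = trans det-C (D≡0 (∣-trans q∣N₀ N₀∣N) (∣N₀⇒isOrder q∣N₀) even)
      where
      D≡0 : ∀ {q k} → q ∣ N → IsOrder q k → IsEven k → D ∅ ≡ + 0
      D≡0 {k = zero} _ isOrder _ with () ← IsOrder.positive isOrder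
      D≡0 {q} {suc k} (divides w N≡wq) isOrder even = even-cycle {∅}
        (DivisorClass.class-period q w (trans N≡wq (*-comm w q)) {v = 1} isOrder (λ (c∣1 , _) → ∣1⇒≡1 c∣1))
        (λ _ _ → refl) even

    module _ (odd-N : IsOdd N) (odd-primes : (p : ℕ) → Prime p → p ∣ N₀ → IsOdd (ord3 p)) where

      odd-divisor : ∀ {d} → d ∣ N → IsOdd d
      odd-divisor {d} (divides q N≡qd) = odd-*⁻ʳ q d (subst IsOdd N≡qd odd-N)

      -- The prime factors of `d` are odd and have odd orders, so some odd power of 3 is 1 modulo
      -- `d`, and the order divides its exponent.
      odd-order : ∀ {d} → d ∣ N₀ → IsOdd (ord3 d)
      odd-order {d} d∣N₀ = from-exponent (odd-exponent factors (All.tabulate good))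
        where
        open PrimeFactorisation (factorise d {{∣N₀⇒nonZero d∣N₀}})
        from-exponent : (∃ λ t → IsOdd t × Unit (product factors) t) → IsOdd (ord3 d)
        from-exponent (t , odd-t , unit-t) =
          order-odd t (∣N₀⇒isOrder d∣N₀) odd-t (subst (λ n → Unit n t) (sym isFactorisation) unit-t)
        good : ∀ {p} → p ∈ factors → IsOdd p × ∃ λ k → IsOdd k × Unit p k
        good {p} p∈ = odd-divisor (∣-trans p∣N₀ N₀∣N) , ord3 p
          , odd-primes p (All.lookup factorsPrime p∈) p∣N₀ , IsOrder.unit (∣N₀⇒isOrder p∣N₀)
          where
          p∣N₀ : p ∣ N₀
          p∣N₀ = ∣-trans (subst (p ∣_) (sym isFactorisation) (∈⇒∣product p∈)) d∣N₀

      divisors-unique : Unique (divisors N₀)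
      divisors-unique = Unique.filter⁺ (_∣? N₀) (Unique.map⁺ suc-injective (Unique.upTo⁺ N₀))

      divisors-sound : ∀ {d} → d ∈ divisors N₀ → d ∣ N₀
      divisors-sound d∈ = proj₂ (∈-filter⁻ (_∣? N₀) {xs = map suc (upTo N₀)} d∈)

      divisors-complete : ∀ {d} → d ∣ N₀ → d ∈ divisors N₀
      divisors-complete {zero}  0∣N₀ = contradiction (0∣⇒≡0 0∣N₀) (≢-nonZero⁻¹ N₀ {{N₀≢0}})
      divisors-complete {suc d} d∣N₀ =
        ∈-filter⁺ (_∣? N₀) (∈-map⁺ suc (∈-upTo⁺ (∣⇒≤ {{N₀≢0}} d∣N₀))) d∣N₀

      final : Stage (λ d → φ d div ord3 d) (divisors N₀)
      final = stage-all (divisors N₀) divisors-unique λ d∈ → let d∣N₀ = divisors-sound d∈ in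
        ∣-trans d∣N₀ N₀∣N , ∣N₀⇒coprime3 d∣N₀ , ∣N₀⇒isOrder d∣N₀ , odd-order d∣N₀

      open Stage final

      -- Multiplying by 3 ^ h makes the additive order of every element divide N₀.
      elt-reaches-S : ∀ y → S (fold (elt y) f h) ≡ true
      elt-reaches-S y = covers (divisors-complete d∣N₀)
        (y′ , 3 ^ h * g , N≡ʰ , y′⊥d , trans (fold-elt h y) (cong elt 3ʰy≡))
        where
        -- Dividing `y` and `N₀` by their gcd gives coprime `y′` and `d`, so `3 ^ h * y` is `y′`
        -- times the cofactor of `d` in `N`.
        g = gcd y N₀
        instance
          g≢0 : NonZero g
          g≢0 = ≢-nonZero (gcd[m,n]≢0 y N₀ (inj₂ (≢-nonZero⁻¹ N₀ {{N₀≢0}})))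
        d = N₀ / g
        y′ = y / g
        dg≡ : d * g ≡ N₀
        dg≡ = m/n*n≡m (gcd[m,n]∣n y N₀)
        d∣N₀ : d ∣ N₀
        d∣N₀ = divides g (trans (sym dg≡) (*-comm d g))
        y′⊥d : Coprime y′ d
        y′⊥d = coprime-/gcd y N₀
        regroup : ∀ a b c → a * (b * c) ≡ b * (a * c)
        regroup = solve-∀
        N≡ʰ : N ≡ d * (3 ^ h * g)
        N≡ʰ = trans N≡3ʰN₀ (trans (cong (3 ^ h *_) (sym dg≡)) (regroup (3 ^ h) d g))
        3ʰy≡ : 3 ^ h * y ≡ y′ * (3 ^ h * g)
        3ʰy≡ = trans (cong (3 ^ h *_) (sym (m/n*n≡m (gcd[m,n]∣m y N₀)))) (regroup (3 ^ h) y′ g)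

      reaches-S : ∀ x → ∃ λ j → S (fold x f j) ≡ true
      reaches-S x = let y , elt≡ = elt-surjective x in
        h , subst (λ x → S (fold x f h) ≡ true) elt≡ (elt-reaches-S y)

      det-odd : det N (C N) ≡ + (2 ^ K N₀) ℤ.* triangleSign m
      det-odd = trans det-C (trans value (cong (+ (2 ^ K N₀) ℤ.*_) (trans (absorb-all {S} reaches-S) det-p)))

-- The three values of the determinant.

odd⇒double : ∀ N → IsOdd N → ∃ λ m → N ≡ suc (double m)
odd⇒double (suc zero)    odd = 0 , refl
odd⇒double (suc (suc N)) odd with m , refl ← odd⇒double N odd = suc m , refl

theorem2p12 : (N h N₀ : ℕ) → IsOdd N → N ≡ 3 ^ h * N₀ → ¬ (3 ∣ N₀) →
    ((Σ ℕ λ p → Prime p × p ∣ N₀ × IsEven (ord3 p)) → det N (C N) ≡ + 0)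
    × (((p : ℕ) → Prime p → p ∣ N₀ → IsOdd (ord3 p)) → (N % 8 ≡ 1 ⊎ N % 8 ≡ 7) →
    det N (C N) ≡ + (2 ^ K N₀))
    × (((p : ℕ) → Prime p → p ∣ N₀ → IsOdd (ord3 p)) → (N % 8 ≡ 3 ⊎ N % 8 ≡ 5) →
    det N (C N) ≡ - (+ (2 ^ K N₀)))
theorem2p12 N h N₀ odd N≡ 3∤N₀ with m , refl ← odd⇒double N odd =
    Collatz.det-even m {h} N≡ 3∤N₀
  , (λ odd-primes N%8 → trans (Collatz.det-odd m {h} N≡ 3∤N₀ odd odd-primes)
      (trans (cong (+ (2 ^ K N₀) ℤ.*_) (triangleSign-±1 m N%8)) (ℤ.*-identityʳ _)))
  , (λ odd-primes N%8 → trans (Collatz.det-odd m {h} N≡ 3∤N₀ odd odd-primes)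
      (trans (cong (+ (2 ^ K N₀) ℤ.*_) (triangleSign-±3 m N%8))
        (trans (ℤ.*-comm (+ (2 ^ K N₀)) (- (+ 1))) (ℤ.-1*i≡-i (+ (2 ^ K N₀))))))
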